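{- Let $n \ge 2$ be an integer and let $T_\Gamma(\mathbb{Z}_n)$ be the total graph of $\mathbb{Z}_n$. Let $p$ be a prime number. Then: (1) If $n$ is even, then $$SO(T_\Gamma(\mathbb{Z}_n)) = \frac{n(n-\phi(n)-1)^2}{\sqrt{2}}.$$ (2) If $n=p^\alpha$ with $\alpha \geq 1$ an integer and $p > 2$, then $$SO(T_\Gamma(\mathbb{Z}_n)) = \frac{\phi(n)(n-\phi(n))^2}{\sqrt{2}} + \frac{(n-\phi(n)-1)^2(n-\phi(n))}{\sqrt{2}}.$$
   Context: For a finite simple graph $G$, the Sombor index is $SO(G)=\sum_{uv\in E(G)}\sqrt{d_u^2+d_v^2}$, the sum being over (unordered) edges, where $d_x$ is the degree of the vertex $x$. For a commutative ring $R$ with unity, $Z(R)$ denotes the set of zero-divisors of $R$, including $0$. The total graph $T_\Gamma(R)$ is the simple graph whose vertices are all elements of $R$, with distinct vertices $x,y$ adjacent if and only if $x+y\in Z(R)$. $\mathbb{Z}_n$ is the ring of integers modulo $n$ and $\phi$ is Euler's totient function. -}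

module Defs where

open import Algebra.Bundles using (CommutativeRing)
open import Algebra.Consequences.Propositional
  using (comm∧idˡ⇒id; comm∧invˡ⇒inv; comm∧distrʳ⇒distr)
open import Data.Empty using (⊥-elim)
open import Data.Fin.Base as Fin using (Fin; toℕ)
import Data.Fin.Properties as Fin
open import Data.Integer.Base as ℤ using (+_; +<+)
import Data.Integer.Properties as ℤ
import Data.Integer.Solver as ℤSolver
open import Data.List.Base using (List; allFin; cartesianProduct; filter; foldr; length; map; upTo)
open import Data.Nat.Base as ℕ using (ℕ; zero; suc)
open import Data.Nat.Coprimality using (coprime?)
open import Data.Nat.DivMod
  using (_%_; _mod_; m%n<n; m%n%n≡m%n; m<n⇒m%n≡m; [m+n]%n≡m%n; %-distribˡ-+; %-distribˡ-*; %-congˡ)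
import Data.Nat.Properties as ℕ
import Data.Nat.Solver as ℕSolver
open import Data.Product.Base using (∃-syntax; _×_; _,_; proj₁; proj₂)
open import Data.Rational.Base as ℚ using (ℚ; 0ℚ; 1ℚ; ∣_∣)
import Data.Rational.Properties as ℚ
import Data.Rational.Solver as ℚSolver
import Data.Rational.Unnormalised.Base as ℚᵘ
import Data.Rational.Unnormalised.Properties as ℚᵘ
open import Data.Sum.Base using (_⊎_; inj₁; inj₂)
open import Level using (Level; 0ℓ; _⊔_)
open import Relation.Binary.Definitions using (Decidable; Symmetric)
open import Relation.Binary.PropositionalEquality
  using (_≡_; _≢_; refl; sym; trans; cong; cong₂; subst; subst₂; isEquivalence; module ≡-Reasoning)
open import Relation.Nullary using (¬_; Dec; yes; no)
open import Relation.Nullary.Decidable using (_×-dec_; _⊎-dec_; ¬?)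

------------------------------------------------------------------------
-- Real numbers: Cauchy sequences of rationals, up to null sequences

Cauchy : (ℕ → ℚ) → Set
Cauchy s = ∀ ε → 0ℚ ℚ.< ε →
  ∃[ N ] (∀ m n → N ℕ.≤ m → N ℕ.≤ n → ∣ s m ℚ.- s n ∣ ℚ.< ε)

record ℝ : Set where
  no-eta-equality
  field
    seq    : ℕ → ℚ
    cauchy : Cauchy seq

open ℝ public

infix 4 _≃_
_≃_ : ℝ → ℝ → Set
x ≃ y = ∀ ε → 0ℚ ℚ.< ε → ∃[ N ] (∀ n → N ℕ.≤ n → ∣ seq x n ℚ.- seq y n ∣ ℚ.< ε)

-- With ℚ's operations applied to variables, `with` unfolds them enormously;
-- identities are therefore stated here in full and used with explicit arguments.
module _ where
  open ℚSolver.+-*-Solver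

  double : ∀ d → d ℚ.+ d ≡ d ℚ.* (1ℚ ℚ.+ 1ℚ)
  double = solve 1 (λ d → d :+ d := d :* (con 1ℚ :+ con 1ℚ)) refl

  cancel-middle : ∀ p c → p ≡ (p ℚ.- c) ℚ.+ c
  cancel-middle = solve 2 (λ p c → p := (p :- c) :+ c) refl

  cancel-front : ∀ q ε → q ℚ.+ ε ℚ.- q ≡ ε
  cancel-front = solve 2 (λ q ε → q :+ ε :- q := ε) refl

  neg-swap : ∀ p q → q ℚ.- p ≡ ℚ.- (p ℚ.- q)
  neg-swap = solve 2 (λ p q → q :- p := :- (p :- q)) refl

  neg-diff : ∀ a b → b ℚ.- a ≡ ℚ.- a ℚ.- ℚ.- b
  neg-diff = solve 2 (λ a b → b :- a := :- a :- :- b) refl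

  +-diff : ∀ a b c d → (a ℚ.- c) ℚ.+ (b ℚ.- d) ≡ (a ℚ.+ b) ℚ.- (c ℚ.+ d)
  +-diff = solve 4 (λ a b c d → (a :- c) :+ (b :- d) := (a :+ b) :- (c :+ d)) refl

  *-diff : ∀ a b c d → (a ℚ.- c) ℚ.* b ℚ.+ (b ℚ.- d) ℚ.* c ≡ a ℚ.* b ℚ.- c ℚ.* d
  *-diff = solve 4 (λ a b c d → (a :- c) :* b :+ (b :- d) :* c := a :* b :- c :* d) refl

  recip-diff : ∀ u v a b →
    (v ℚ.- u) ℚ.* a ℚ.* b ≡ a ℚ.* (v ℚ.* b) ℚ.- b ℚ.* (u ℚ.* a)
  recip-diff = solve 4 (λ u v a b →
    (v :- u) :* a :* b := a :* (v :* b) :- b :* (u :* a)) refl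

  square-gap : ∀ r h → (r ℚ.+ h) ℚ.* (r ℚ.+ h) ≡ r ℚ.* r ℚ.+ h ℚ.* (r ℚ.+ r ℚ.+ h)
  square-gap = solve 2 (λ r h → (r :+ h) :* (r :+ h) := r :* r :+ h :* (r :+ r :+ h)) refl

2ℚ : ℚ
2ℚ = 1ℚ ℚ.+ 1ℚ

0<1 : 0ℚ ℚ.< 1ℚ
0<1 = ℚ.positive⁻¹ 1ℚ

quotient : ∀ {ε B} → 0ℚ ℚ.< ε → 0ℚ ℚ.< B → ∃[ δ ] (0ℚ ℚ.< δ × δ ℚ.* B ≡ ε)
quotient {ε} {B} 0<ε 0<B = ε ℚ.* 1/B , ℚ.positive⁻¹ _ {{ℚ.pos*pos⇒pos ε 1/B}} , eq
  where
  instance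
    pε = ℚ.positive 0<ε
    pB = ℚ.positive 0<B
    nB = ℚ.pos⇒nonZero B
  1/B = ℚ.1/ B
  instance
    p1/B = ℚ.1/pos⇒pos B
  eq : ε ℚ.* 1/B ℚ.* B ≡ ε
  eq = trans (ℚ.*-assoc ε 1/B B)
         (trans (cong (ε ℚ.*_) (ℚ.*-inverseˡ B)) (ℚ.*-identityʳ ε))

half : ∀ {ε} → 0ℚ ℚ.< ε → ∃[ δ ] (0ℚ ℚ.< δ × δ ℚ.+ δ ≡ ε)
half 0<ε = let δ , 0<δ , eq = quotient 0<ε (ℚ.positive⁻¹ 2ℚ) in
  δ , 0<δ , trans (double δ) eq

∣+∣< : ∀ {p q δ η} → ∣ p ∣ ℚ.< δ → ∣ q ∣ ℚ.< η → ∣ p ℚ.+ q ∣ ℚ.< δ ℚ.+ η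
∣+∣< {p} {q} p<δ q<η = ℚ.≤-<-trans (ℚ.∣p+q∣≤∣p∣+∣q∣ p q) (ℚ.+-mono-< p<δ q<η)

∣*∣< : ∀ {p q δ B} → ∣ p ∣ ℚ.< δ → 0ℚ ℚ.< B → ∣ q ∣ ℚ.≤ B → ∣ p ℚ.* q ∣ ℚ.< δ ℚ.* B
∣*∣< {p} {q} {δ} {B} p<δ 0<B q≤B = begin-strict
  ∣ p ℚ.* q ∣       ≡⟨ ℚ.∣p*q∣≡∣p∣*∣q∣ p q ⟩
  ∣ p ∣ ℚ.* ∣ q ∣   ≤⟨ ℚ.*-monoˡ-≤-nonNeg ∣ p ∣ {{ℚ.∣-∣-nonNeg p}} q≤B ⟩
  ∣ p ∣ ℚ.* B       <⟨ ℚ.*-monoˡ-<-pos B {{ℚ.positive 0<B}} p<δ ⟩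
  δ ℚ.* B           ∎
  where open ℚ.≤-Reasoning

∣-∣< : ∀ {p q ε} → p ℚ.< q ℚ.+ ε → q ℚ.< p ℚ.+ ε → ∣ p ℚ.- q ∣ ℚ.< ε
∣-∣< {p} {q} {ε} p<q+ε q<p+ε with ℚ.∣p∣≡p∨∣p∣≡-p (p ℚ.- q)
... | inj₁ eq = subst₂ ℚ._<_ (sym eq)
  (cancel-front q ε) (ℚ.+-monoˡ-< (ℚ.- q) p<q+ε)
... | inj₂ eq = subst₂ ℚ._<_
  (trans (neg-swap p q) (sym eq))
  (cancel-front p ε) (ℚ.+-monoˡ-< (ℚ.- p) q<p+ε)

bounded : ∀ x → ∃[ B ] (0ℚ ℚ.< B × ∃[ N ] (∀ n → N ℕ.≤ n → ∣ seq x n ∣ ℚ.≤ B))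
bounded x = 1ℚ ℚ.+ ∣ c ∣ , 0<B , N , bound
  where
  N = proj₁ (cauchy x 1ℚ 0<1)
  close = proj₂ (cauchy x 1ℚ 0<1)
  c = seq x N
  0<B : 0ℚ ℚ.< 1ℚ ℚ.+ ∣ c ∣
  0<B = ℚ.+-mono-<-≤ 0<1 (ℚ.0≤∣p∣ c)
  bound : ∀ n → N ℕ.≤ n → ∣ seq x n ∣ ℚ.≤ 1ℚ ℚ.+ ∣ c ∣
  bound n N≤n = begin
    ∣ seq x n ∣                     ≡⟨ cong ∣_∣ (cancel-middle (seq x n) c) ⟩
    ∣ (seq x n ℚ.- c) ℚ.+ c ∣       ≤⟨ ℚ.∣p+q∣≤∣p∣+∣q∣ (seq x n ℚ.- c) c ⟩
    ∣ seq x n ℚ.- c ∣ ℚ.+ ∣ c ∣     ≤⟨ ℚ.+-monoˡ-≤ ∣ c ∣ (ℚ.<⇒≤ (close n N N≤n ℕ.≤-refl)) ⟩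
    1ℚ ℚ.+ ∣ c ∣                    ∎
    where open ℚ.≤-Reasoning

+-cauchy : ∀ x y → Cauchy (λ n → seq x n ℚ.+ seq y n)
+-cauchy x y ε 0<ε =
  let δ , 0<δ , δ+δ≡ε = half 0<ε
      M , xc = cauchy x δ 0<δ
      N , yc = cauchy y δ 0<δ
  in M ℕ.⊔ N , λ m n m≥ n≥ → subst₂ ℚ._<_
    (cong ∣_∣ (+-diff (seq x m) (seq y m) (seq x n) (seq y n)))
    δ+δ≡ε
    (∣+∣< {seq x m ℚ.- seq x n} {seq y m ℚ.- seq y n}
      (xc m n (ℕ.m⊔n≤o⇒m≤o M N m≥) (ℕ.m⊔n≤o⇒m≤o M N n≥))
      (yc m n (ℕ.m⊔n≤o⇒n≤o M N m≥) (ℕ.m⊔n≤o⇒n≤o M N n≥)))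

neg-cauchy : ∀ x → Cauchy (λ n → ℚ.- seq x n)
neg-cauchy x ε 0<ε = let N , xc = cauchy x ε 0<ε in N , λ m n m≥ n≥ → subst (ℚ._< ε)
  (cong ∣_∣ (neg-diff (seq x m) (seq x n)))
  (xc n m n≥ m≥)

*-cauchy : ∀ x y → Cauchy (λ n → seq x n ℚ.* seq y n)
*-cauchy x y ε 0<ε =
  let δ , 0<δ , δ+δ≡ε = half 0<ε
      B , 0<B , K , x≤B = bounded x
      C , 0<C , L , y≤C = bounded y
      η , 0<η , ηC≡δ = quotient 0<δ 0<C
      θ , 0<θ , θB≡δ = quotient 0<δ 0<B
      M , xc = cauchy x η 0<η
      N , yc = cauchy y θ 0<θ
  in (K ℕ.⊔ L) ℕ.⊔ (M ℕ.⊔ N) , λ m n m≥ n≥ →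
  let m≥₁ = ℕ.m⊔n≤o⇒m≤o (K ℕ.⊔ L) (M ℕ.⊔ N) m≥
      n≥₁ = ℕ.m⊔n≤o⇒m≤o (K ℕ.⊔ L) (M ℕ.⊔ N) n≥
      m≥₂ = ℕ.m⊔n≤o⇒n≤o (K ℕ.⊔ L) (M ℕ.⊔ N) m≥
      n≥₂ = ℕ.m⊔n≤o⇒n≤o (K ℕ.⊔ L) (M ℕ.⊔ N) n≥
      dx  = seq x m ℚ.- seq x n
      dy  = seq y m ℚ.- seq y n
  in subst₂ ℚ._<_
    (cong ∣_∣ (*-diff (seq x m) (seq y m) (seq x n) (seq y n)))
    (trans (cong₂ ℚ._+_ ηC≡δ θB≡δ) δ+δ≡ε)
    (∣+∣< {dx ℚ.* seq y m} {dy ℚ.* seq x n}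
      (∣*∣< {dx} {seq y m}
        (xc m n (ℕ.m⊔n≤o⇒m≤o M N m≥₂) (ℕ.m⊔n≤o⇒m≤o M N n≥₂))
        0<C (y≤C m (ℕ.m⊔n≤o⇒n≤o K L m≥₁)))
      (∣*∣< {dy} {seq x n}
        (yc m n (ℕ.m⊔n≤o⇒n≤o M N m≥₂) (ℕ.m⊔n≤o⇒n≤o M N n≥₂))
        0<B (x≤B n (ℕ.m⊔n≤o⇒m≤o K L n≥₁))))

const : ℚ → ℝ
const q .seq    _     = q
const q .cauchy ε 0<ε = 0 , λ _ _ _ _ →
  subst (ℚ._< ε) (sym (cong ∣_∣ (ℚ.+-inverseʳ q))) 0<ε

ι : ℕ → ℝ
ι n = const (+ n ℚ./ 1)

infixl 6 _+_ _-_
infixl 7 _*_ _÷_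
infix  8 -_
infixl 9 _² _⁻¹
infix  10 √_
infix  4 _#0

_+_ : ℝ → ℝ → ℝ
(x + y) .seq n  = seq x n ℚ.+ seq y n
(x + y) .cauchy = +-cauchy x y

-_ : ℝ → ℝ
(- x) .seq n  = ℚ.- seq x n
(- x) .cauchy = neg-cauchy x

_-_ : ℝ → ℝ → ℝ
x - y = x + (- y)

_*_ : ℝ → ℝ → ℝ
(x * y) .seq n  = seq x n ℚ.* seq y n
(x * y) .cauchy = *-cauchy x y

_² : ℝ → ℝ
x ² = x * x

sumℝ : List ℝ → ℝ
sumℝ = foldr _+_ (ι 0)

-- Apartness from zero; constructively this positive form is what inversion needs.
record _#0 (x : ℝ) : Set where
  constructor mk#0
  field
    gap      : ℚ
    0<gap    : 0ℚ ℚ.< gap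
    from     : ℕ
    bounds   : ∀ n → from ℕ.≤ n → gap ℚ.≤ ∣ seq x n ∣

-- Termwise inverse; a sequence apart from zero meets the arbitrary value at 0 only finitely often.
recip : ℚ → ℚ
recip q with q ℚ.≟ 0ℚ
... | yes _  = 0ℚ
... | no q≢0 = (ℚ.1/ q) {{ℚ.≢-nonZero q≢0}}

recip-inverseʳ : ∀ {q} → q ≢ 0ℚ → q ℚ.* recip q ≡ 1ℚ
recip-inverseʳ {q} q≢0 with q ℚ.≟ 0ℚ
... | yes q≡0 = ⊥-elim (q≢0 q≡0)
... | no  q≢0 = ℚ.*-inverseʳ q {{ℚ.≢-nonZero q≢0}}

0<∣q∣⇒q≢0 : ∀ {q δ} → 0ℚ ℚ.< δ → δ ℚ.≤ ∣ q ∣ → q ≢ 0ℚ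
0<∣q∣⇒q≢0 0<δ δ≤ refl = ℚ.<-irrefl refl (ℚ.<-≤-trans 0<δ δ≤)

recip-cauchy : ∀ x → x #0 → Cauchy (λ n → recip (seq x n))
recip-cauchy x (mk#0 δ 0<δ N₀ δ≤) ε 0<ε =
  let θ , 0<θ , θK≡ε = quotient 0<ε 0<K
      η , 0<η , ηK≡θ = quotient 0<θ 0<K
      N , xc = cauchy x η 0<η
  in N₀ ℕ.⊔ N , λ m n m≥ n≥ →
  let m≥₀ = ℕ.m⊔n≤o⇒m≤o N₀ N m≥
      n≥₀ = ℕ.m⊔n≤o⇒m≤o N₀ N n≥
      u   = seq x m
      v   = seq x n
      d   = v ℚ.- u
  in subst₂ ℚ._<_ (cong ∣_∣ (difference m n m≥₀ n≥₀))
    (trans (cong (ℚ._* K) ηK≡θ) θK≡ε)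
    (∣*∣< {d ℚ.* recip u} {recip v}
      (∣*∣< {d} {recip u} (xc n m (ℕ.m⊔n≤o⇒n≤o N₀ N n≥) (ℕ.m⊔n≤o⇒n≤o N₀ N m≥))
        0<K (recip≤ m m≥₀))
      0<K (recip≤ n n≥₀))
  where
  1/δ = quotient 0<1 0<δ
  K = proj₁ 1/δ
  0<K = proj₁ (proj₂ 1/δ)
  Kδ≡1 = proj₂ (proj₂ 1/δ)

  inv : ∀ n → N₀ ℕ.≤ n → seq x n ℚ.* recip (seq x n) ≡ 1ℚ
  inv n n≥ = recip-inverseʳ (0<∣q∣⇒q≢0 0<δ (δ≤ n n≥))

  recip≤ : ∀ n → N₀ ℕ.≤ n → ∣ recip (seq x n) ∣ ℚ.≤ K
  recip≤ n n≥ = ℚ.*-cancelʳ-≤-pos δ {{ℚ.positive 0<δ}} (begin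
    ∣ r ∣ ℚ.* δ              ≤⟨ ℚ.*-monoˡ-≤-nonNeg ∣ r ∣ {{ℚ.∣-∣-nonNeg r}} (δ≤ n n≥) ⟩
    ∣ r ∣ ℚ.* ∣ seq x n ∣    ≡⟨ ℚ.∣p*q∣≡∣p∣*∣q∣ r (seq x n) ⟨
    ∣ r ℚ.* seq x n ∣        ≡⟨ cong ∣_∣ (trans (ℚ.*-comm r (seq x n)) (inv n n≥)) ⟩
    1ℚ                       ≡⟨ Kδ≡1 ⟨
    K ℚ.* δ                  ∎)
    where
    open ℚ.≤-Reasoning
    r = recip (seq x n)

  difference : ∀ m n → N₀ ℕ.≤ m → N₀ ℕ.≤ n →
    (seq x n ℚ.- seq x m) ℚ.* recip (seq x m) ℚ.* recip (seq x n) ≡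
    recip (seq x m) ℚ.- recip (seq x n)
  difference m n m≥ n≥ = begin
    (v ℚ.- u) ℚ.* a ℚ.* b                   ≡⟨ recip-diff u v a b ⟩
    a ℚ.* (v ℚ.* b) ℚ.- b ℚ.* (u ℚ.* a)     ≡⟨ cong₂ (λ s t → a ℚ.* s ℚ.- b ℚ.* t) (inv n n≥) (inv m m≥) ⟩
    a ℚ.* 1ℚ ℚ.- b ℚ.* 1ℚ                   ≡⟨ cong₂ ℚ._-_ (ℚ.*-identityʳ a) (ℚ.*-identityʳ b) ⟩
    a ℚ.- b                                 ∎
    where
    open ≡-Reasoning
    u = seq x m
    v = seq x n
    a = recip u
    b = recip v

_⁻¹ : (x : ℝ) {{_ : x #0}} → ℝ
(x ⁻¹) .seq n = recip (seq x n)
_⁻¹ x {{x#0}} .cauchy = recip-cauchy x x#0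

_÷_ : (x y : ℝ) {{_ : y #0}} → ℝ
x ÷ y = x * (y ⁻¹)

eventually-≡⇒≃ : ∀ x y → (∃[ N ] (∀ n → N ℕ.≤ n → seq x n ≡ seq y n)) → x ≃ y
eventually-≡⇒≃ x y (N , eq) ε 0<ε = N , λ n n≥ → subst (ℚ._< ε)
  (sym (cong ∣_∣ (trans (cong (ℚ._- seq y n) (eq n n≥)) (ℚ.+-inverseʳ (seq y n))))) 0<ε

÷-* : ∀ x y {{_ : y #0}} → (x ÷ y) * y ≃ x
÷-* x y {{y#0}} = eventually-≡⇒≃ ((x ÷ y) * y) x (from , λ n n≥ →
  trans (ℚ.*-assoc (seq x n) (recip (seq y n)) (seq y n))
    (trans (cong (seq x n ℚ.*_) (trans (ℚ.*-comm (recip (seq y n)) (seq y n))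
        (recip-inverseʳ (0<∣q∣⇒q≢0 0<gap (bounds n n≥)))))
      (ℚ.*-identityʳ (seq x n))))
  where open _#0 y#0

------------------------------------------------------------------------
-- Square roots of natural numbers

-- ⌊√m⌋
isqrt : ℕ → ℕ
isqrt zero    = 0
isqrt (suc m) with suc (isqrt m) ℕ.* suc (isqrt m) ℕ.≤? suc m
... | yes _ = suc (isqrt m)
... | no  _ = isqrt m

isqrt-lower : ∀ m → isqrt m ℕ.* isqrt m ℕ.≤ m
isqrt-lower zero    = ℕ.z≤n
isqrt-lower (suc m) with suc (isqrt m) ℕ.* suc (isqrt m) ℕ.≤? suc m
... | yes le = le
... | no  _  = ℕ.m≤n⇒m≤1+n (isqrt-lower m)

isqrt-upper : ∀ m → m ℕ.< suc (isqrt m) ℕ.* suc (isqrt m)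
isqrt-upper zero    = ℕ.s≤s ℕ.z≤n
isqrt-upper (suc m) with suc (isqrt m) ℕ.* suc (isqrt m) ℕ.≤? suc m
... | yes _  = ℕ.≤-<-trans (isqrt-upper m) (ℕ.*-mono-< (ℕ.n<1+n (suc (isqrt m))) (ℕ.n<1+n (suc (isqrt m))))
... | no ¬le = ℕ.≰⇒> ¬le

-- ⌊√m · (k+1)⌋, so that the sequence below satisfies √-seq m k ≤ √m < √-seq m k + 1/(k+1).
√-num : ℕ → ℕ → ℕ
√-num m k = isqrt (m ℕ.* (suc k ℕ.* suc k))

√-seq : ℕ → ℕ → ℚ
√-seq m k = + √-num m k ℚ./ suc k

square-cancel-< : ∀ {a b} → a ℕ.* a ℕ.< b ℕ.* b → a ℕ.< b
square-cancel-< {a} {b} lt = ℕ.≰⇒> λ b≤a → ℕ.<⇒≱ lt (ℕ.*-mono-≤ b≤a b≤a)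

toℚᵘ-/ : ∀ i n → ℚ.toℚᵘ (i ℚ./ suc n) ℚᵘ.≃ ℚᵘ.mkℚᵘ i n
toℚᵘ-/ i n = ℚ.toℚᵘ-fromℚᵘ (ℚᵘ.mkℚᵘ i n)

/-mono-< : ∀ a c b d → a ℕ.* suc d ℕ.< b ℕ.* suc c → + a ℚ./ suc c ℚ.< + b ℚ./ suc d
/-mono-< a c b d lt = ℚ.toℚᵘ-cancel-<
  (ℚᵘ.<-respˡ-≃ (ℚᵘ.≃-sym (toℚᵘ-/ (+ a) c))
    (ℚᵘ.<-respʳ-≃ (ℚᵘ.≃-sym (toℚᵘ-/ (+ b) d))
      (ℚᵘ.*<* (subst₂ ℤ._<_ (ℤ.pos-* a (suc d)) (ℤ.pos-* b (suc c)) (+<+ lt)))))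

/-mono-≤ : ∀ a c b d → a ℕ.* suc d ℕ.≤ b ℕ.* suc c → + a ℚ./ suc c ℚ.≤ + b ℚ./ suc d
/-mono-≤ a c b d le = ℚ.toℚᵘ-cancel-≤
  (ℚᵘ.≤-respˡ-≃ (ℚᵘ.≃-sym (toℚᵘ-/ (+ a) c))
    (ℚᵘ.≤-respʳ-≃ (ℚᵘ.≃-sym (toℚᵘ-/ (+ b) d))
      (ℚᵘ.*≤* (subst₂ ℤ._≤_ (ℤ.pos-* a (suc d)) (ℤ.pos-* b (suc c)) (ℤ.+≤+ le)))))

suc-/ : ∀ a k → + suc a ℚ./ suc k ≡ + a ℚ./ suc k ℚ.+ + 1 ℚ./ suc k
suc-/ a k = ℚ.toℚᵘ-injective (begin
  ℚ.toℚᵘ (+ suc a ℚ./ suc k)                              ≈⟨ toℚᵘ-/ (+ suc a) k ⟩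
  ℚᵘ.mkℚᵘ (+ suc a) k                                     ≈⟨ ℚᵘ.*≡* eq ⟩
  ℚᵘ.mkℚᵘ (+ a) k ℚᵘ.+ ℚᵘ.mkℚᵘ (+ 1) k                    ≈⟨ ℚᵘ.+-cong (toℚᵘ-/ (+ a) k) (toℚᵘ-/ (+ 1) k) ⟨
  ℚ.toℚᵘ (+ a ℚ./ suc k) ℚᵘ.+ ℚ.toℚᵘ (+ 1 ℚ./ suc k)      ≈⟨ ℚ.toℚᵘ-homo-+ (+ a ℚ./ suc k) (+ 1 ℚ./ suc k) ⟨
  ℚ.toℚᵘ (+ a ℚ./ suc k ℚ.+ + 1 ℚ./ suc k)                ∎)
  where
  open ℚᵘ.≃-Reasoning
  open ℤSolver.+-*-Solver
  eq : + suc a ℤ.* (+ suc k ℤ.* + suc k) ≡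
       (+ a ℤ.* + suc k ℤ.+ + 1 ℤ.* + suc k) ℤ.* + suc k
  eq = solve 2 (λ a k → (con (+ 1) :+ a) :* (k :* k) := (a :* k :+ con (+ 1) :* k) :* k)
         refl (+ a) (+ suc k)

√-step : ∀ m j k → √-seq m j ℚ.< √-seq m k ℚ.+ + 1 ℚ./ suc k
√-step m j k = subst (√-seq m j ℚ.<_) (suc-/ t k) (/-mono-< s j (suc t) k
  (square-cancel-< {s ℕ.* K} {suc t ℕ.* J} (begin-strict
  (s ℕ.* K) ℕ.* (s ℕ.* K)              ≡⟨ swap s K ⟩
  (s ℕ.* s) ℕ.* (K ℕ.* K)              ≤⟨ ℕ.*-monoˡ-≤ (K ℕ.* K) (isqrt-lower (m ℕ.* (J ℕ.* J))) ⟩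
  m ℕ.* (J ℕ.* J) ℕ.* (K ℕ.* K)        ≡⟨ solve 3 (λ m j k → m :* j :* k := m :* k :* j) refl m (J ℕ.* J) (K ℕ.* K) ⟩
  m ℕ.* (K ℕ.* K) ℕ.* (J ℕ.* J)        <⟨ ℕ.*-monoˡ-< (J ℕ.* J) (isqrt-upper (m ℕ.* (K ℕ.* K))) ⟩
  (suc t ℕ.* suc t) ℕ.* (J ℕ.* J)      ≡⟨ swap (suc t) J ⟨
  (suc t ℕ.* J) ℕ.* (suc t ℕ.* J)      ∎)))
  where
  open ℕ.≤-Reasoning
  open ℕSolver.+-*-Solver
  J = suc j
  K = suc k
  s = √-num m j
  t = √-num m k
  swap : ∀ a b → (a ℕ.* b) ℕ.* (a ℕ.* b) ≡ (a ℕ.* a) ℕ.* (b ℕ.* b)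
  swap = solve 2 (λ a b → (a :* b) :* (a :* b) := (a :* a) :* (b :* b)) refl

archimedean : ∀ ε → 0ℚ ℚ.< ε → ∃[ N ] (∀ k → N ℕ.≤ k → + 1 ℚ./ suc k ℚ.< ε)
archimedean ε 0<ε = go ε (ℚ.positive 0<ε)
  where
  go : ∀ ε → ℚ.Positive ε → ∃[ N ] (∀ k → N ℕ.≤ k → + 1 ℚ./ suc k ℚ.< ε)
  go ε@(ℚ.mkℚ (+ suc p) q _) _ = suc q , λ k q<k →
    subst (+ 1 ℚ./ suc k ℚ.<_) (ℚ.fromℚᵘ-toℚᵘ ε) (/-mono-< 1 k (suc p) q (begin-strict
      1 ℕ.* suc q          ≡⟨ ℕ.*-identityˡ (suc q) ⟩
      suc q                <⟨ ℕ.s≤s q<k ⟩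
      suc k                ≤⟨ ℕ.m≤n*m (suc k) (suc p) ⟩
      suc p ℕ.* suc k      ∎))
    where open ℕ.≤-Reasoning

√-cauchy : ∀ m → Cauchy (√-seq m)
√-cauchy m ε 0<ε = let N , small = archimedean ε 0<ε in N , λ j k j≥ k≥ → ∣-∣<
  (ℚ.<-trans (√-step m j k) (ℚ.+-monoʳ-< (√-seq m k) (small k k≥)))
  (ℚ.<-trans (√-step m k j) (ℚ.+-monoʳ-< (√-seq m j) (small j j≥)))

√_ : ℕ → ℝ
(√ m) .seq    = √-seq m
(√ m) .cauchy = √-cauchy m

√-nonneg : ∀ m k → 0ℚ ℚ.≤ seq (√ m) k
√-nonneg m k = /-mono-≤ 0 0 (√-num m k) k ℕ.z≤n

≤-√-num : ∀ m .{{_ : ℕ.NonZero m}} k → suc k ℕ.≤ √-num m k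
≤-√-num m k = ℕ.s≤s⁻¹ (square-cancel-< (begin-strict
  suc k ℕ.* suc k                                  ≤⟨ ℕ.m≤n*m (suc k ℕ.* suc k) m ⟩
  m ℕ.* (suc k ℕ.* suc k)                          <⟨ isqrt-upper (m ℕ.* (suc k ℕ.* suc k)) ⟩
  suc (√-num m k) ℕ.* suc (√-num m k)              ∎))
  where open ℕ.≤-Reasoning

instance
  √#0 : ∀ {m} .{{_ : ℕ.NonZero m}} → (√ m) #0
  √#0 {m} = mk#0 1ℚ 0<1 0 λ k _ →
    subst (1ℚ ℚ.≤_) (sym (ℚ.0≤p⇒∣p∣≡p (√-nonneg m k)))
      (/-mono-≤ 1 0 (√-num m k) k (subst₂ ℕ._≤_ (sym (ℕ.*-identityˡ (suc k)))
        (sym (ℕ.*-identityʳ (√-num m k))) (≤-√-num m k)))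

/-* : ∀ a b c d → + a ℚ./ suc c ℚ.* (+ b ℚ./ suc d) ≡ + (a ℕ.* b) ℚ./ (suc c ℕ.* suc d)
/-* a b c d = ℚ.toℚᵘ-injective (begin
  ℚ.toℚᵘ (+ a ℚ./ suc c ℚ.* (+ b ℚ./ suc d))            ≈⟨ ℚ.toℚᵘ-homo-* (+ a ℚ./ suc c) (+ b ℚ./ suc d) ⟩
  ℚ.toℚᵘ (+ a ℚ./ suc c) ℚᵘ.* ℚ.toℚᵘ (+ b ℚ./ suc d)    ≈⟨ ℚᵘ.*-cong (toℚᵘ-/ (+ a) c) (toℚᵘ-/ (+ b) d) ⟩
  ℚᵘ.mkℚᵘ (+ a ℤ.* + b) (d ℕ.+ c ℕ.* suc d)             ≡⟨ cong (λ i → ℚᵘ.mkℚᵘ i (d ℕ.+ c ℕ.* suc d)) (sym (ℤ.pos-* a b)) ⟩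
  ℚᵘ.mkℚᵘ (+ (a ℕ.* b)) (d ℕ.+ c ℕ.* suc d)             ≈⟨ toℚᵘ-/ (+ (a ℕ.* b)) (d ℕ.+ c ℕ.* suc d) ⟨
  ℚ.toℚᵘ (+ (a ℕ.* b) ℚ./ (suc c ℕ.* suc d))            ∎)
  where open ℚᵘ.≃-Reasoning

√-seq²≤ : ∀ m k → √-seq m k ℚ.* √-seq m k ℚ.≤ + m ℚ./ 1
√-seq²≤ m k = subst (ℚ._≤ + m ℚ./ 1) (sym (/-* s s k k))
  (/-mono-≤ (s ℕ.* s) (k ℕ.+ k ℕ.* suc k) m 0
    (subst (ℕ._≤ m ℕ.* (suc k ℕ.* suc k)) (sym (ℕ.*-identityʳ (s ℕ.* s)))
      (isqrt-lower (m ℕ.* (suc k ℕ.* suc k)))))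
  where s = √-num m k

<√-seq² : ∀ m k → let h = + 1 ℚ./ suc k in
  + m ℚ./ 1 ℚ.< (√-seq m k ℚ.+ h) ℚ.* (√-seq m k ℚ.+ h)
<√-seq² m k = subst (+ m ℚ./ 1 ℚ.<_)
  (trans (sym (/-* (suc s) (suc s) k k)) (cong₂ ℚ._*_ (suc-/ s k) (suc-/ s k)))
  (/-mono-< m 0 (suc s ℕ.* suc s) (k ℕ.+ k ℕ.* suc k)
    (subst (m ℕ.* (suc k ℕ.* suc k) ℕ.<_) (sym (ℕ.*-identityʳ (suc s ℕ.* suc s)))
      (isqrt-upper (m ℕ.* (suc k ℕ.* suc k)))))
  where s = √-num m k

√-square : ∀ m → √ m * √ m ≃ ι m
√-square m ε 0<ε =
  let B , 0<B , M , r≤B = bounded (√ m)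
      C = B ℚ.+ B ℚ.+ 1ℚ
      0<C = ℚ.+-mono-< (ℚ.+-mono-< 0<B 0<B) 0<1
      η , 0<η , ηC≡ε = quotient 0<ε 0<C
      N , small = archimedean η 0<η
  in M ℕ.⊔ N , λ k k≥ →
    let r = √-seq m k
        h = + 1 ℚ./ suc k
        h≥0 : 0ℚ ℚ.≤ h
        h≥0 = /-mono-≤ 0 0 1 k ℕ.z≤n
        h≤1 : h ℚ.≤ 1ℚ
        h≤1 = /-mono-≤ 1 k 1 0 (ℕ.s≤s ℕ.z≤n)
        r≤ : r ℚ.≤ B
        r≤ = subst (ℚ._≤ B) (ℚ.0≤p⇒∣p∣≡p (√-nonneg m k)) (r≤B k (ℕ.m⊔n≤o⇒m≤o M N k≥))
        gap≤ : h ℚ.* (r ℚ.+ r ℚ.+ h) ℚ.≤ h ℚ.* C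
        gap≤ = ℚ.*-monoˡ-≤-nonNeg h {{ℚ.nonNegative h≥0}} (ℚ.+-mono-≤ (ℚ.+-mono-≤ r≤ r≤) h≤1)
        gap< : h ℚ.* (r ℚ.+ r ℚ.+ h) ℚ.< ε
        gap< = ℚ.≤-<-trans gap≤ (subst (h ℚ.* C ℚ.<_) ηC≡ε
          (ℚ.*-monoˡ-<-pos C {{ℚ.positive 0<C}} (small k (ℕ.m⊔n≤o⇒n≤o M N k≥))))
    in ∣-∣< {r ℚ.* r} {+ m ℚ./ 1}
      (ℚ.≤-<-trans (√-seq²≤ m k)
        (subst (ℚ._< + m ℚ./ 1 ℚ.+ ε) (ℚ.+-identityʳ (+ m ℚ./ 1))
          (ℚ.+-monoʳ-< (+ m ℚ./ 1) 0<ε)))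
      (ℚ.<-trans (subst (+ m ℚ./ 1 ℚ.<_) (square-gap r h) (<√-seq² m k))
        (ℚ.+-monoʳ-< (r ℚ.* r) gap<))

------------------------------------------------------------------------
-- Graphs and the Sombor index

record SimpleGraph {v} (V : Set v) (e : Level) : Set (v ⊔ Level.suc e) where
  field
    Adj    : V → V → Set e
    symm   : Symmetric Adj
    irrefl : ∀ {x} → ¬ Adj x x

open SimpleGraph public

module _ {e k} (G : SimpleGraph (Fin k) e) (adj? : Decidable (Adj G)) where

  degree : Fin k → ℕ
  degree u = length (filter (adj? u) (allFin k))

  -- Each unordered edge is listed once, as the pair with increasing entries.
  edges : List (Fin k × Fin k)
  edges = filter (λ (u , v) → (u Fin.<? v) ×-dec adj? u v)
                 (cartesianProduct (allFin k) (allFin k))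

  SO : ℝ
  SO = sumℝ (map (λ (u , v) → √ (degree u ℕ.^ 2 ℕ.+ degree v ℕ.^ 2)) edges)

------------------------------------------------------------------------
-- The total graph of a commutative ring

module _ {c ℓ} (R : CommutativeRing c ℓ) where
  private module R = CommutativeRing R

  -- Zero is included by convention.
  IsZeroDivisor : R.Carrier → Set (c ⊔ ℓ)
  IsZeroDivisor x = x R.≈ R.0# ⊎ ∃[ y ] (¬ y R.≈ R.0# × x R.* y R.≈ R.0#)

  TΓ : SimpleGraph R.Carrier (c ⊔ ℓ)
  TΓ = record
    { Adj    = λ x y → ¬ x R.≈ y × IsZeroDivisor (x R.+ y)
    ; symm   = λ { {x} {y} (x≉y , z) → (λ y≈x → x≉y (R.sym y≈x)) , resp (R.+-comm x y) z }
    ; irrefl = λ { (x≉x , _) → x≉x R.refl }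
    }
    where
    resp : ∀ {x y} → x R.≈ y → IsZeroDivisor x → IsZeroDivisor y
    resp x≈y (inj₁ x≈0)             = inj₁ (R.trans (R.sym x≈y) x≈0)
    resp x≈y (inj₂ (z , z≉0 , xz≈0)) = inj₂ (z , z≉0 , R.trans (R.*-congʳ (R.sym x≈y)) xz≈0)

------------------------------------------------------------------------
-- Integers modulo n, represented by their least residues

module _ (n : ℕ) .{{_ : ℕ.NonZero n}} where
  π : ℕ → Fin n
  π m = m mod n

  _⊕_ _⊗_ : Fin n → Fin n → Fin n
  a ⊕ b = π (toℕ a ℕ.+ toℕ b)
  a ⊗ b = π (toℕ a ℕ.* toℕ b)

  ⊖_ : Fin n → Fin n
  ⊖ a = π (n ℕ.∸ toℕ a)

  toℕ-π : ∀ m → toℕ (π m) ≡ m % n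
  toℕ-π m = Fin.toℕ-fromℕ< (m%n<n m n)

  π-cong : ∀ {l m} → l % n ≡ m % n → π l ≡ π m
  π-cong {l} {m} eq = Fin.toℕ-injective (trans (toℕ-π l) (trans eq (sym (toℕ-π m))))

  π-toℕ : ∀ a → π (toℕ a) ≡ a
  π-toℕ a = Fin.toℕ-injective (trans (toℕ-π (toℕ a)) (m<n⇒m%n≡m (Fin.toℕ<n a)))

  toℕ-π-% : ∀ m → toℕ (π m) % n ≡ m % n
  toℕ-π-% m = trans (%-congˡ (toℕ-π m)) (m%n%n≡m%n m n)

  π-+ : ∀ l m → π l ⊕ π m ≡ π (l ℕ.+ m)
  π-+ l m = π-cong (trans (%-distribˡ-+ (toℕ (π l)) (toℕ (π m)) n)
    (trans (cong₂ (λ i j → (i ℕ.+ j) % n) (toℕ-π-% l) (toℕ-π-% m)) (sym (%-distribˡ-+ l m n))))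

  π-* : ∀ l m → π l ⊗ π m ≡ π (l ℕ.* m)
  π-* l m = π-cong (trans (%-distribˡ-* (toℕ (π l)) (toℕ (π m)) n)
    (trans (cong₂ (λ i j → (i ℕ.* j) % n) (toℕ-π-% l) (toℕ-π-% m)) (sym (%-distribˡ-* l m n))))

  π-+ˡ : ∀ m a → π m ⊕ a ≡ π (m ℕ.+ toℕ a)
  π-+ˡ m a = trans (cong (π m ⊕_) (sym (π-toℕ a))) (π-+ m (toℕ a))

  π-*ˡ : ∀ m a → π m ⊗ a ≡ π (m ℕ.* toℕ a)
  π-*ˡ m a = trans (cong (π m ⊗_) (sym (π-toℕ a))) (π-* m (toℕ a))

  ⊕-comm : ∀ a b → a ⊕ b ≡ b ⊕ a
  ⊕-comm a b = cong π (ℕ.+-comm (toℕ a) (toℕ b))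

  ⊗-comm : ∀ a b → a ⊗ b ≡ b ⊗ a
  ⊗-comm a b = cong π (ℕ.*-comm (toℕ a) (toℕ b))

  ⊕-assoc : ∀ a b c → (a ⊕ b) ⊕ c ≡ a ⊕ (b ⊕ c)
  ⊕-assoc a b c = trans (π-+ˡ _ c)
    (trans (cong π (trans (ℕ.+-assoc (toℕ a) (toℕ b) (toℕ c)) (ℕ.+-comm (toℕ a) _)))
      (sym (trans (⊕-comm a (b ⊕ c)) (π-+ˡ _ a))))

  ⊗-assoc : ∀ a b c → (a ⊗ b) ⊗ c ≡ a ⊗ (b ⊗ c)
  ⊗-assoc a b c = trans (π-*ˡ _ c)
    (trans (cong π (trans (ℕ.*-assoc (toℕ a) (toℕ b) (toℕ c)) (ℕ.*-comm (toℕ a) _)))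
      (sym (trans (⊗-comm a (b ⊗ c)) (π-*ˡ _ a))))

  ⊕-identityˡ : ∀ a → π 0 ⊕ a ≡ a
  ⊕-identityˡ a = trans (π-+ˡ 0 a) (π-toℕ a)

  ⊗-identityˡ : ∀ a → π 1 ⊗ a ≡ a
  ⊗-identityˡ a = trans (π-*ˡ 1 a) (trans (cong π (ℕ.*-identityˡ (toℕ a))) (π-toℕ a))

  ⊖-inverseˡ : ∀ a → (⊖ a) ⊕ a ≡ π 0
  ⊖-inverseˡ a = trans (π-+ˡ _ a)
    (trans (cong π (ℕ.m∸n+n≡m (Fin.toℕ≤n a))) (π-cong ([m+n]%n≡m%n 0 n)))

  ⊗-distribʳ-⊕ : ∀ c a b → (a ⊕ b) ⊗ c ≡ (a ⊗ c) ⊕ (b ⊗ c)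
  ⊗-distribʳ-⊕ c a b = trans (π-*ˡ _ c)
    (trans (cong π (ℕ.*-distribʳ-+ (toℕ c) (toℕ a) (toℕ b))) (sym (π-+ _ _)))

  ℤ/ : CommutativeRing 0ℓ 0ℓ
  ℤ/ = record
    { Carrier = Fin n
    ; _≈_     = _≡_
    ; _+_     = _⊕_
    ; _*_     = _⊗_
    ; -_      = ⊖_
    ; 0#      = π 0
    ; 1#      = π 1
    ; isCommutativeRing = record
      { isRing = record
        { +-isAbelianGroup = record
          { isGroup = record
            { isMonoid = record
              { isSemigroup = record
                { isMagma = record { isEquivalence = isEquivalence ; ∙-cong = cong₂ _⊕_ }
                ; assoc   = ⊕-assoc
                }
              ; identity = comm∧idˡ⇒id ⊕-comm ⊕-identityˡ
              }
            ; inverse = comm∧invˡ⇒inv ⊕-comm ⊖-inverseˡ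
            ; ⁻¹-cong = cong ⊖_
            }
          ; comm = ⊕-comm
          }
        ; *-cong     = cong₂ _⊗_
        ; *-assoc    = ⊗-assoc
        ; *-identity = comm∧idˡ⇒id ⊗-comm ⊗-identityˡ
        ; distrib    = comm∧distrʳ⇒distr (cong₂ _⊕_) ⊗-comm ⊗-distribʳ-⊕
        }
      ; *-comm = ⊗-comm
      }
    }

  isZeroDivisor? : ∀ x → Dec (IsZeroDivisor ℤ/ x)
  isZeroDivisor? x =
    (x Fin.≟ π 0) ⊎-dec Fin.any? (λ y → ¬? (y Fin.≟ π 0) ×-dec (x ⊗ y Fin.≟ π 0))

  TΓ-adj? : Decidable (Adj (TΓ ℤ/))
  TΓ-adj? x y = ¬? (x Fin.≟ y) ×-dec isZeroDivisor? (x ⊕ y)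

------------------------------------------------------------------------
-- Euler's totient: the number of 1 ≤ k ≤ n coprime to n

φ : ℕ → ℕ
φ n = length (filter (coprime? n) (map suc (upTo n)))

{-# OPTIONS --safe #-}
-- In ℤ/n the zero-divisors are the residues not coprime to n, so there are
-- z = n − φ(n) of them. Since y ↦ x + y is a bijection, x has degree z − 1 or z
-- according as 2x is a zero-divisor or not. For even n the graph is therefore
-- (z − 1)-regular. For n = p^α with p odd, the zero-divisors are the multiples
-- of p, so 2x is one exactly when x is, and an edge joins two zero-divisors or
-- two units. In both cases adjacent vertices have equal degrees, so an edge uv
-- contributes √2 d_u, and the sum over edges is (Σ_u d_u²) / √2.

module Submission where

open import Defs
open import Data.Nat.Base using (ℕ; NonZero; _≥_; _>_; _^_)
open import Data.Nat.Divisibility using (_∣_)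
open import Data.Nat.Primality using (Prime)
open import Data.Nat.Primality using (prime⇒irreducible; euclidsLemma; ¬prime[1])
open import Data.Product.Base using (_×_)
open import Relation.Binary.PropositionalEquality using (_≡_)

open import Algebra.Bundles using (CommutativeRing)
import Algebra.Properties.Semiring.Sum
open import Data.Bool.Base using (true; false; if_then_else_)
open import Data.Fin.Base as Fin using (Fin; zero; suc; toℕ)
import Data.Fin.Properties as Fin
open import Data.Fin.Permutation using (Permutation′; permutation)
open import Data.Integer.Base using (+_)
open import Data.List.Base
  using ([]; _∷_; _++_; allFin; applyUpTo; cartesianProduct; filter; length; map; tabulate)
import Data.List.Properties as List
open import Data.List.Relation.Unary.All as All using (All; []; _∷_)
open import Data.List.Relation.Unary.All.Properties using (all-filter)
open import Data.Nat.Base as ℕ using (zero; suc)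
open import Data.Nat.Coprimality as Coprimality using (Coprime; coprime?)
import Data.Nat.Divisibility as ∣
open import Data.Nat.DivMod using (_%_; m<n⇒m%n≡m)
open import Data.Nat.GCD using (gcd; gcd[m,n]∣m; gcd[m,n]∣n)
open import Data.Nat.ListAction using () renaming (sum to sumᴸ)
open import Data.Nat.ListAction.Properties using (sum-++)
import Data.Nat.Properties as ℕ
import Data.Nat.Solver as ℕSolver
open import Data.Product.Base using (_,_; proj₁; proj₂)
open import Data.Rational.Base as ℚ using (ℚ; 0ℚ; 1ℚ; ∣_∣)
import Data.Rational.Properties as ℚ
import Data.Rational.Solver as ℚSolver
open import Data.Sum.Base using (inj₁; inj₂)
open import Function.Base using (_∘_; id)
open import Relation.Binary.Definitions using (Decidable; tri<; tri≈; tri>)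
open import Relation.Binary.PropositionalEquality
  using (_≢_; refl; sym; trans; cong; cong₂; subst; subst₂; module ≡-Reasoning)
open import Relation.Nullary using (¬_; Dec; yes; no; does; contradiction)
open import Relation.Nullary.Decidable using (_×-dec_; decidable-stable; dec-true; dec-false)
import Relation.Unary as Unary

open Algebra.Properties.Semiring.Sum ℕ.+-*-semiring
  using (sum-syntax; sum-cong-≗; ∑-comm; ∑-distrib-+; *-distribʳ-sum; ∑-permute)

-- Equality of reals as a congruence.

≗⇒≃ : ∀ {x y} → (∀ k → seq x k ≡ seq y k) → x ≃ y
≗⇒≃ {x} {y} eq = eventually-≡⇒≃ x y (0 , λ k _ → eq k)

module _ where
  open ℚSolver.+-*-Solver

  -‿telescope : ∀ a b c → (a ℚ.- b) ℚ.+ (b ℚ.- c) ≡ a ℚ.- c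
  -‿telescope = solve 3 (λ a b c → (a :- b) :+ (b :- c) := a :- c) refl

  *-distribʳ-- : ∀ a b c → (a ℚ.- b) ℚ.* c ≡ a ℚ.* c ℚ.- b ℚ.* c
  *-distribʳ-- = solve 3 (λ a b c → (a :- b) :* c := a :* c :- b :* c) refl

≃-trans : ∀ {x y z} → x ≃ y → y ≃ z → x ≃ z
≃-trans {x} {y} {z} x≃y y≃z ε 0<ε =
  let δ , 0<δ , δ+δ≡ε = half 0<ε
      M , xy = x≃y δ 0<δ
      N , yz = y≃z δ 0<δ
  in M ℕ.⊔ N , λ k k≥ → subst₂ ℚ._<_
    (cong ∣_∣ (-‿telescope (seq x k) (seq y k) (seq z k))) δ+δ≡ε
    (∣+∣< {seq x k ℚ.- seq y k} {seq y k ℚ.- seq z k}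
      (xy k (ℕ.m⊔n≤o⇒m≤o M N k≥)) (yz k (ℕ.m⊔n≤o⇒n≤o M N k≥)))

+-cong : ∀ {x x′ y y′} → x ≃ x′ → y ≃ y′ → x + y ≃ x′ + y′
+-cong {x} {x′} {y} {y′} x≃x′ y≃y′ ε 0<ε =
  let δ , 0<δ , δ+δ≡ε = half 0<ε
      M , xx′ = x≃x′ δ 0<δ
      N , yy′ = y≃y′ δ 0<δ
  in M ℕ.⊔ N , λ k k≥ → subst₂ ℚ._<_
    (cong ∣_∣ (+-diff (seq x k) (seq y k) (seq x′ k) (seq y′ k))) δ+δ≡ε
    (∣+∣< {seq x k ℚ.- seq x′ k} {seq y k ℚ.- seq y′ k}
      (xx′ k (ℕ.m⊔n≤o⇒m≤o M N k≥)) (yy′ k (ℕ.m⊔n≤o⇒n≤o M N k≥)))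

*-congʳ : ∀ {x x′ y} → x ≃ x′ → x * y ≃ x′ * y
*-congʳ {x} {x′} {y} x≃x′ ε 0<ε =
  let B , 0<B , M , y≤B = bounded y
      δ , 0<δ , δB≡ε = quotient 0<ε 0<B
      N , xx′ = x≃x′ δ 0<δ
  in M ℕ.⊔ N , λ k k≥ → subst₂ ℚ._<_
    (cong ∣_∣ (*-distribʳ-- (seq x k) (seq x′ k) (seq y k))) δB≡ε
    (∣*∣< {seq x k ℚ.- seq x′ k} {seq y k}
      (xx′ k (ℕ.m⊔n≤o⇒n≤o M N k≥)) 0<B (y≤B k (ℕ.m⊔n≤o⇒m≤o M N k≥)))

-- Naturals as rationals.

fromℕ : ℕ → ℚ
fromℕ m = + m ℚ./ 1

fromℕ-+ : ∀ a b → fromℕ (a ℕ.+ b) ≡ fromℕ a ℚ.+ fromℕ b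
fromℕ-+ zero    b = sym (ℚ.+-identityˡ (fromℕ b))
fromℕ-+ (suc a) b = begin
  fromℕ (suc (a ℕ.+ b))                    ≡⟨ suc-/ (a ℕ.+ b) 0 ⟩
  fromℕ (a ℕ.+ b) ℚ.+ 1ℚ                   ≡⟨ cong (ℚ._+ 1ℚ) (fromℕ-+ a b) ⟩
  fromℕ a ℚ.+ fromℕ b ℚ.+ 1ℚ               ≡⟨ swap (fromℕ a) (fromℕ b) 1ℚ ⟩
  fromℕ a ℚ.+ 1ℚ ℚ.+ fromℕ b               ≡⟨ cong (ℚ._+ fromℕ b) (suc-/ a 0) ⟨
  fromℕ (suc a) ℚ.+ fromℕ b                ∎
  where
  open ≡-Reasoning
  open ℚSolver.+-*-Solver
  swap : ∀ a b c → a ℚ.+ b ℚ.+ c ≡ a ℚ.+ c ℚ.+ b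
  swap = solve 3 (λ a b c → a :+ b :+ c := a :+ c :+ b) refl

fromℕ-* : ∀ a b → fromℕ (a ℕ.* b) ≡ fromℕ a ℚ.* fromℕ b
fromℕ-* a b = sym (/-* a b 0 0)

-- Taking the sum as a hypothesis keeps truncated subtraction out: the differences in the closed
-- formulas are identified through natural numbers already known to add up to `n` or to the number
-- of zero-divisors.
fromℕ-∸ : ∀ a b {c} → a ℕ.+ b ≡ c → fromℕ c ℚ.- fromℕ b ≡ fromℕ a
fromℕ-∸ a b refl = trans (cong (ℚ._- fromℕ b) (fromℕ-+ a b)) (cancel (fromℕ a) (fromℕ b))
  where
  open ℚSolver.+-*-Solver
  cancel : ∀ a b → a ℚ.+ b ℚ.- b ≡ a
  cancel = solve 2 (λ a b → a :+ b :- b := a) refl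

-- Scaling of square roots.

square-cancel-≤ : ∀ {a b} → a ℕ.* a ℕ.≤ b ℕ.* b → a ℕ.≤ b
square-cancel-≤ le = ℕ.≮⇒≥ λ b<a → ℕ.<⇒≱ (ℕ.*-mono-< b<a b<a) le

module _ (d m k : ℕ) where
  open ℕ.≤-Reasoning
  open ℕSolver.+-*-Solver
  private
    swap : ∀ a b → (a ℕ.* b) ℕ.* (a ℕ.* b) ≡ (a ℕ.* a) ℕ.* (b ℕ.* b)
    swap = solve 2 (λ a b → (a :* b) :* (a :* b) := (a :* a) :* (b :* b)) refl

    K² = suc k ℕ.* suc k
    s = √-num m k
    t = √-num (d ℕ.* d ℕ.* m) k

  -- Here `s` and `t` are the integer parts of √m (k+1) and d √m (k+1). Multiplying s ≤ √m (k+1) < s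
  -- + 1 by `d` and comparing squares bounds `t` on both sides; the upper bound is not strict
  -- because `d` may be 0.
  √-num-scale-lower : d ℕ.* s ℕ.≤ t
  √-num-scale-lower = ℕ.s≤s⁻¹ (square-cancel-< (begin-strict
    (d ℕ.* s) ℕ.* (d ℕ.* s)          ≡⟨ swap d s ⟩
    (d ℕ.* d) ℕ.* (s ℕ.* s)          ≤⟨ ℕ.*-monoʳ-≤ (d ℕ.* d) (isqrt-lower (m ℕ.* K²)) ⟩
    (d ℕ.* d) ℕ.* (m ℕ.* K²)         ≡⟨ ℕ.*-assoc (d ℕ.* d) m K² ⟨
    d ℕ.* d ℕ.* m ℕ.* K²             <⟨ isqrt-upper (d ℕ.* d ℕ.* m ℕ.* K²) ⟩
    suc t ℕ.* suc t                  ∎))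

  √-num-scale-upper : t ℕ.≤ d ℕ.* suc s
  √-num-scale-upper = square-cancel-≤ (begin
    t ℕ.* t                          ≤⟨ isqrt-lower (d ℕ.* d ℕ.* m ℕ.* K²) ⟩
    d ℕ.* d ℕ.* m ℕ.* K²             ≡⟨ ℕ.*-assoc (d ℕ.* d) m K² ⟩
    (d ℕ.* d) ℕ.* (m ℕ.* K²)         ≤⟨ ℕ.*-monoʳ-≤ (d ℕ.* d) (ℕ.<⇒≤ (isqrt-upper (m ℕ.* K²))) ⟩
    (d ℕ.* d) ℕ.* (suc s ℕ.* suc s)  ≡⟨ swap d (suc s) ⟨
    (d ℕ.* suc s) ℕ.* (d ℕ.* suc s)  ∎)

/-monoˡ-≤ : ∀ {a b} k → a ℕ.≤ b → + a ℚ./ suc k ℚ.≤ + b ℚ./ suc k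
/-monoˡ-≤ {a} {b} k a≤b = /-mono-≤ a k b k (ℕ.*-monoˡ-≤ (suc k) a≤b)

/-*ˡ : ∀ a b k → + (a ℕ.* b) ℚ./ suc k ≡ fromℕ a ℚ.* (+ b ℚ./ suc k)
/-*ˡ a b k = sym (trans (/-* a b 0 k) (cong (λ j → + (a ℕ.* b) ℚ./ suc j) (ℕ.+-identityʳ k)))

-- By the two bounds on the numerators, the k-th terms of the two sides differ by at most d/(k+1).
√-scale : ∀ d m → √ (d ℕ.* d ℕ.* m) ≃ ι d * √ m
√-scale d m ε 0<ε =
  -- The tolerance is divided by `suc d` instead of `d`, which may be 0.
  let 0<D : 0ℚ ℚ.< fromℕ (suc d)
      0<D = /-mono-< 0 0 (suc d) 0 (ℕ.s≤s ℕ.z≤n)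
      η , 0<η , ηD≡ε = quotient 0<ε 0<D
      N , small = archimedean η 0<η
  in N , λ k k≥ →
  let s = √-num m k
      t = √-num (d ℕ.* d ℕ.* m) k
      h = + 1 ℚ./ suc k
      h≥0 : 0ℚ ℚ.≤ h
      h≥0 = /-mono-≤ 0 0 1 k ℕ.z≤n
      gap< : fromℕ d ℚ.* h ℚ.< ε
      gap< = ℚ.≤-<-trans
        (ℚ.*-monoʳ-≤-nonNeg h {{ℚ.nonNegative h≥0}} (/-monoˡ-≤ 0 (ℕ.n≤1+n d)))
        (subst₂ ℚ._<_ (ℚ.*-comm h (fromℕ (suc d))) ηD≡ε
          (ℚ.*-monoˡ-<-pos (fromℕ (suc d)) {{ℚ.positive 0<D}} (small k k≥)))
      upper : √-seq (d ℕ.* d ℕ.* m) k ℚ.≤ fromℕ d ℚ.* √-seq m k ℚ.+ fromℕ d ℚ.* h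
      upper = subst (+ t ℚ./ suc k ℚ.≤_)
        (trans (/-*ˡ d (suc s) k) (trans (cong (fromℕ d ℚ.*_) (suc-/ s k))
          (ℚ.*-distribˡ-+ (fromℕ d) (√-seq m k) h)))
        (/-monoˡ-≤ k (√-num-scale-upper d m k))
      lower : fromℕ d ℚ.* √-seq m k ℚ.≤ √-seq (d ℕ.* d ℕ.* m) k
      lower = subst (ℚ._≤ + t ℚ./ suc k) (/-*ˡ d s k) (/-monoˡ-≤ k (√-num-scale-lower d m k))
  in ∣-∣< {√-seq (d ℕ.* d ℕ.* m) k} {fromℕ d ℚ.* √-seq m k}
    (ℚ.≤-<-trans upper (ℚ.+-monoʳ-< (fromℕ d ℚ.* √-seq m k) gap<))
    (ℚ.≤-<-trans lower (subst (ℚ._< √-seq (d ℕ.* d ℕ.* m) k ℚ.+ ε)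
      (ℚ.+-identityʳ (√-seq (d ℕ.* d ℕ.* m) k)) (ℚ.+-monoʳ-< (√-seq (d ℕ.* d ℕ.* m) k) 0<ε)))

-- s √2 = s √2 √2 / √2 = 2 s / √2
*√2≃÷√2 : ∀ s x → (∀ k → seq x k ≡ fromℕ (2 ℕ.* s)) → ι s * √ 2 ≃ x ÷ √ 2
*√2≃÷√2 s x x≡2s = ≃-trans {ι s * √ 2} {√ 2 * √ 2 * (ι s * r)} {x ÷ √ 2}
  (≗⇒≃ {ι s * √ 2} {√ 2 * √ 2 * (ι s * r)} λ k → sym
    (trans (regroup (√-seq 2 k) (fromℕ s) (seq r k))
      (trans (cong (fromℕ s ℚ.* √-seq 2 k ℚ.*_) (inverse k))
        (ℚ.*-identityʳ (fromℕ s ℚ.* √-seq 2 k)))))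
  (≃-trans {√ 2 * √ 2 * (ι s * r)} {ι 2 * (ι s * r)} {x ÷ √ 2}
    (*-congʳ {√ 2 * √ 2} {ι 2} {ι s * r} (√-square 2))
    (≗⇒≃ {ι 2 * (ι s * r)} {x ÷ √ 2} λ k →
      trans (sym (ℚ.*-assoc (fromℕ 2) (fromℕ s) (seq r k)))
        (cong (ℚ._* seq r k) (sym (trans (x≡2s k) (fromℕ-* 2 s))))))
  where
  r = (√ 2) ⁻¹
  open ℚSolver.+-*-Solver
  regroup : ∀ u s v → (u ℚ.* u) ℚ.* (s ℚ.* v) ≡ s ℚ.* u ℚ.* (u ℚ.* v)
  regroup = solve 3 (λ u s v → (u :* u) :* (s :* v) := s :* u :* (u :* v)) refl
  open _#0 (√#0 {2})
  inverse : ∀ k → √-seq 2 k ℚ.* seq r k ≡ 1ℚ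
  inverse k = recip-inverseʳ (0<∣q∣⇒q≢0 0<gap (bounds k ℕ.z≤n))

-- Counting with indicator sums.

𝟙 : ∀ {a} {A : Set a} → Dec A → ℕ
𝟙 a? = if does a? then 1 else 0

module _ {a} {A : Set a} (a? : Dec A) where
  𝟙-yes : A → 𝟙 a? ≡ 1
  𝟙-yes a = cong (if_then 1 else 0) (dec-true a? a)

  𝟙-no : ¬ A → 𝟙 a? ≡ 0
  𝟙-no ¬a = cong (if_then 1 else 0) (dec-false a? ¬a)

𝟙-¬ : ∀ {a b} {A : Set a} {B : Set b} (a? : Dec A) (b? : Dec B) →
  (A → ¬ B) → (¬ A → B) → 𝟙 a? ℕ.+ 𝟙 b? ≡ 1
𝟙-¬ (yes a) b? a⇒¬b ¬a⇒b = cong suc (𝟙-no b? (a⇒¬b a))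
𝟙-¬ (no ¬a) b? a⇒¬b ¬a⇒b = 𝟙-yes b? (¬a⇒b ¬a)

𝟙-⇔ : ∀ {a b} {A : Set a} {B : Set b} (a? : Dec A) (b? : Dec B) → (A → B) → (B → A) → 𝟙 a? ≡ 𝟙 b?
𝟙-⇔ (yes a) b? f g = sym (𝟙-yes b? (f a))
𝟙-⇔ (no ¬a) b? f g = sym (𝟙-no b? (¬a ∘ g))

module _ {a p} {A : Set a} {P : A → Set p} (P? : Unary.Decidable P) where
  length-filter-∷ : ∀ x xs → length (filter P? (x ∷ xs)) ≡ 𝟙 (P? x) ℕ.+ length (filter P? xs)
  length-filter-∷ x xs with does (P? x)
  ... | true  = refl
  ... | false = refl

  length-filter-tabulate : ∀ {k} (f : Fin k → A) →
    length (filter P? (tabulate f)) ≡ ∑[ i < k ] 𝟙 (P? (f i))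
  length-filter-tabulate {zero}  f = refl
  length-filter-tabulate {suc k} f = trans (length-filter-∷ (f zero) (tabulate (f ∘ suc)))
    (cong (𝟙 (P? (f zero)) ℕ.+_) (length-filter-tabulate (f ∘ suc)))

  module _ (w : A → ℕ) where
    sum-filter-tabulate : ∀ {k} (f : Fin k → A) →
      sumᴸ (map w (filter P? (tabulate f))) ≡ ∑[ i < k ] (𝟙 (P? (f i)) ℕ.* w (f i))
    sum-filter-tabulate {zero}  f = refl
    sum-filter-tabulate {suc k} f with ih ← sum-filter-tabulate (f ∘ suc) | does (P? (f zero))
    ... | true  = cong₂ ℕ._+_ (sym (ℕ.+-identityʳ (w (f zero)))) ih
    ... | false = ih

module _ {a b p} {A : Set a} {B : Set b} {P : A × B → Set p}
         (P? : Unary.Decidable P) (w : A × B → ℕ) where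
  sum-filter-product : ∀ {k l} (f : Fin k → A) (g : Fin l → B) →
    sumᴸ (map w (filter P? (cartesianProduct (tabulate f) (tabulate g)))) ≡
    ∑[ i < k ] ∑[ j < l ] (𝟙 (P? (f i , g j)) ℕ.* w (f i , g j))
  sum-filter-product {zero}      f g = refl
  sum-filter-product {suc k} {l} f g = begin
    sumᴸ (map w (filter P? (row ++ rest)))
      ≡⟨ cong (sumᴸ ∘ map w) (List.filter-++ P? row rest) ⟩
    sumᴸ (map w (filter P? row ++ filter P? rest))
      ≡⟨ cong sumᴸ (List.map-++ w (filter P? row) (filter P? rest)) ⟩
    sumᴸ (map w (filter P? row) ++ map w (filter P? rest))
      ≡⟨ sum-++ (map w (filter P? row)) (map w (filter P? rest)) ⟩
    sumᴸ (map w (filter P? row)) ℕ.+ sumᴸ (map w (filter P? rest))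
      ≡⟨ cong₂ ℕ._+_
           (trans (cong (sumᴸ ∘ map w ∘ filter P?) (List.map-tabulate g (f zero ,_)))
             (sum-filter-tabulate P? w (λ j → f zero , g j)))
           (sum-filter-product (f ∘ suc) g) ⟩
    ∑[ i < suc k ] ∑[ j < l ] (𝟙 (P? (f i , g j)) ℕ.* w (f i , g j)) ∎
    where
    open ≡-Reasoning
    row = map (f zero ,_) (tabulate g)
    rest = cartesianProduct (tabulate (f ∘ suc)) (tabulate g)

-- Sombor index of a graph whose adjacent vertices have equal degrees.

module _ {e k} (G : SimpleGraph (Fin k) e) (adj? : Decidable (Adj G))
         (balanced : ∀ {u v} → Adj G u v → degree G adj? u ≡ degree G adj? v) where
  private
    d = degree G adj?

    up? : ∀ (uv : Fin k × Fin k) → Dec (proj₁ uv Fin.< proj₂ uv × Adj G (proj₁ uv) (proj₂ uv))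
    up? (u , v) = (u Fin.<? v) ×-dec adj? u v

    up : Fin k → Fin k → ℕ
    up u v = 𝟙 (up? (u , v)) ℕ.* d u

    weight-swap : ∀ {u v} → v Fin.< u → 𝟙 (adj? u v) ℕ.* d u ≡ up v u
    weight-swap {u} {v} v<u = by-cases (adj? u v)
      where
      by-cases : Dec (Adj G u v) → 𝟙 (adj? u v) ℕ.* d u ≡ up v u
      by-cases (yes uv) = cong₂ ℕ._*_
        (trans (𝟙-yes (adj? u v) uv) (sym (𝟙-yes (up? (v , u)) (v<u , symm G uv))))
        (balanced uv)
      by-cases (no ¬uv) = trans
        (cong (ℕ._* d u) (𝟙-no (adj? u v) ¬uv))
        (sym (cong (ℕ._* d v) (𝟙-no (up? (v , u)) (¬uv ∘ symm G ∘ proj₂))))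

    -- An adjacent ordered pair is either increasing, and counted by `up u v`, or decreasing, and
    -- counted by `up v u`, where balance allows `d v` to stand for `d u`. On the diagonal
    -- everything vanishes by irreflexivity.
    adj-split : ∀ u v → 𝟙 (adj? u v) ℕ.* d u ≡ up u v ℕ.+ up v u
    adj-split u v with Fin.<-cmp u v
    ... | tri< u<v _ v≮u = trans
      (cong (ℕ._* d u) (𝟙-⇔ (adj? u v) (up? (u , v)) (u<v ,_) proj₂))
      (trans (sym (ℕ.+-identityʳ (up u v)))
        (cong (λ i → up u v ℕ.+ i ℕ.* d v) (sym (𝟙-no (up? (v , u)) (v≮u ∘ proj₁)))))
    ... | tri≈ _ refl _ = trans
      (cong (ℕ._* d u) (𝟙-no (adj? u u) (irrefl G)))
      (sym (cong (λ i → i ℕ.* d u ℕ.+ i ℕ.* d u) (𝟙-no (up? (u , u)) (irrefl G ∘ proj₂))))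
    ... | tri> u≮v _ v<u = trans
      (weight-swap v<u)
      (cong (λ i → i ℕ.* d u ℕ.+ up v u) (sym (𝟙-no (up? (u , v)) (u≮v ∘ proj₁))))

  edgeSum : ℕ
  edgeSum = sumᴸ (map (d ∘ proj₁) (edges G adj?))

  -- A weighted handshake argument: summed over all ordered pairs, `adj-split` meets each edge
  -- twice, while the row of `u` in the adjacency matrix sums to `d u`.
  2*edgeSum : 2 ℕ.* edgeSum ≡ ∑[ u < k ] (d u ℕ.* d u)
  2*edgeSum = begin
    2 ℕ.* edgeSum
      ≡⟨ cong (edgeSum ℕ.+_) (ℕ.+-identityʳ edgeSum) ⟩
    edgeSum ℕ.+ edgeSum
      ≡⟨ cong₂ ℕ._+_ edgeSum≡ (trans edgeSum≡ (∑-comm up)) ⟩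
    ∑[ u < k ] ∑[ v < k ] up u v ℕ.+ ∑[ u < k ] ∑[ v < k ] up v u
      ≡⟨ ∑-distrib-+ (λ u → ∑[ v < k ] up u v) (λ u → ∑[ v < k ] up v u) ⟨
    ∑[ u < k ] (∑[ v < k ] up u v ℕ.+ ∑[ v < k ] up v u)
      ≡⟨ sum-cong-≗ (λ u → ∑-distrib-+ (up u) (λ v → up v u)) ⟨
    ∑[ u < k ] ∑[ v < k ] (up u v ℕ.+ up v u)
      ≡⟨ sum-cong-≗ (λ u → sum-cong-≗ (adj-split u)) ⟨
    ∑[ u < k ] ∑[ v < k ] (𝟙 (adj? u v) ℕ.* d u)
      ≡⟨ sum-cong-≗ (λ u → *-distribʳ-sum (d u) (λ v → 𝟙 (adj? u v))) ⟨
    ∑[ u < k ] ((∑[ v < k ] 𝟙 (adj? u v)) ℕ.* d u)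
      ≡⟨ sum-cong-≗ (λ u → cong (ℕ._* d u) (length-filter-tabulate (adj? u) id)) ⟨
    ∑[ u < k ] (d u ℕ.* d u)
      ∎
    where
    open ≡-Reasoning
    edgeSum≡ : edgeSum ≡ ∑[ u < k ] ∑[ v < k ] up u v
    edgeSum≡ = sum-filter-product up? (d ∘ proj₁) id id

  -- Each term is √(2 d²) = d √2 by `√-scale`. The list is arbitrary, with equality of degrees as
  -- its only property, so that induction on it goes through.
  sumℝ-edges : ∀ {es} → All (λ (u , v) → d u ≡ d v) es →
    sumℝ (map (λ (u , v) → √ (d u ^ 2 ℕ.+ d v ^ 2)) es) ≃ ι (sumᴸ (map (d ∘ proj₁) es)) * √ 2
  sumℝ-edges []                            =
    ≗⇒≃ {ι 0} {ι 0 * √ 2} λ i → sym (ℚ.*-zeroˡ (√-seq 2 i))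
  sumℝ-edges {(u , v) ∷ es} (du≡dv ∷ eqs) =
    ≃-trans {√ (d u ^ 2 ℕ.+ d v ^ 2) + rest} {ι (d u) * √ 2 + ι D * √ 2} {ι (d u ℕ.+ D) * √ 2}
      (+-cong {√ (d u ^ 2 ℕ.+ d v ^ 2)} {ι (d u) * √ 2} {rest} {ι D * √ 2}
        (subst (λ m → √ m ≃ ι (d u) * √ 2) square (√-scale (d u) 2))
        (sumℝ-edges eqs))
      (≗⇒≃ {ι (d u) * √ 2 + ι D * √ 2} {ι (d u ℕ.+ D) * √ 2} λ i →
        trans (sym (ℚ.*-distribʳ-+ (√-seq 2 i) (fromℕ (d u)) (fromℕ D)))
          (cong (ℚ._* √-seq 2 i) (sym (fromℕ-+ (d u) D))))
    where
    D = sumᴸ (map (d ∘ proj₁) es)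
    rest = sumℝ (map (λ (u , v) → √ (d u ^ 2 ℕ.+ d v ^ 2)) es)
    square : d u ℕ.* d u ℕ.* 2 ≡ d u ^ 2 ℕ.+ d v ^ 2
    square rewrite sym du≡dv =
      solve 1 (λ x → x :* x :* con 2 := x :* (x :* con 1) :+ x :* (x :* con 1)) refl (d u)
      where open ℕSolver.+-*-Solver

  -- The index equals √2 times `edgeSum`, and twice `edgeSum` is the sum of squared degrees. The
  -- numerator `x` is constrained only through its terms, so that a formula with real subtractions
  -- can be supplied as it stands.
  SO-balanced : ∀ x → (∀ i → seq x i ≡ fromℕ (∑[ u < k ] (d u ℕ.* d u))) →
    SO G adj? ≃ x ÷ √ 2
  SO-balanced x x≡ = ≃-trans {SO G adj?} {ι edgeSum * √ 2} {x ÷ √ 2}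
    (sumℝ-edges (All.map (balanced ∘ proj₂) (all-filter up? (cartesianProduct (allFin k) (allFin k)))))
    (*√2≃÷√2 edgeSum x λ i → trans (x≡ i) (cong fromℕ (sym 2*edgeSum)))

-- Sums over initial segments of ℕ.

length-filter-applyUpTo : ∀ {a p} {A : Set a} {P : A → Set p} (P? : Unary.Decidable P) (f : ℕ → A) k →
  length (filter P? (applyUpTo f k)) ≡ ∑[ i < k ] 𝟙 (P? (f (toℕ i)))
length-filter-applyUpTo P? f zero    = refl
length-filter-applyUpTo P? f (suc k) = trans (length-filter-∷ P? (f 0) (applyUpTo (f ∘ suc) k))
  (cong (𝟙 (P? (f 0)) ℕ.+_) (length-filter-applyUpTo P? (f ∘ suc) k))

-- Both sides are f 0 + ... + f k. This reconciles the range 1, ..., n of the totient with the range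
-- 0, ..., n - 1 of `Fin n`.
∑-shift : ∀ (f : ℕ → ℕ) k → f 0 ℕ.+ ∑[ i < k ] f (suc (toℕ i)) ≡ ∑[ i < k ] f (toℕ i) ℕ.+ f k
∑-shift f zero    = ℕ.+-identityʳ (f 0)
∑-shift f (suc k) = trans (cong (f 0 ℕ.+_) (∑-shift (f ∘ suc) k))
  (sym (ℕ.+-assoc (f 0) (∑[ i < k ] f (suc (toℕ i))) (f (suc k))))

∑-const : ∀ k c → ∑[ i < k ] c ≡ k ℕ.* c
∑-const zero    c = refl
∑-const (suc k) c = cong (c ℕ.+_) (∑-const k c)

∑-𝟙-≟ : ∀ {k} (x : Fin k) → ∑[ y < k ] 𝟙 (x Fin.≟ y) ≡ 1
∑-𝟙-≟ {suc k} zero    = cong suc (trans (∑-const k 0) (ℕ.*-zeroʳ k))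
-- The term at `zero` computes to 0, and the Boolean of `suc x ≟ suc y` computes to that of `x ≟ y`.
∑-𝟙-≟ {suc k} (suc x) = ∑-𝟙-≟ x

-- Coprimality and prime powers.

Coprime-* : ∀ {a b m} → Coprime a m → Coprime b m → Coprime (a ℕ.* b) m
Coprime-* ca cb (d∣ab , d∣m) =
  -- A common divisor `d` of `a * b` and `m` is coprime to `a`, since whatever divides both `d` and
  -- `a` also divides `m`. Hence `d` divides `b`.
  cb (Coprimality.coprime-divisor (λ (e∣d , e∣a) → ca (e∣a , ∣.∣-trans e∣d d∣m)) d∣ab , d∣m)

module _ {p} (pp : Prime p) where
  ∤⇒coprime : ∀ {m} → ¬ p ∣ m → Coprime p m
  ∤⇒coprime p∤m (d∣p , d∣m) with prime⇒irreducible pp d∣p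
  ... | inj₁ d≡1  = d≡1
  ... | inj₂ refl = contradiction d∣m p∤m

  ∤⇒coprime-^ : ∀ α {m} → ¬ p ∣ m → Coprime (p ^ α) m
  ∤⇒coprime-^ zero    p∤m = Coprimality.1-coprimeTo _
  ∤⇒coprime-^ (suc α) p∤m = Coprime-* (∤⇒coprime p∤m) (∤⇒coprime-^ α p∤m)

  -- Euclid's lemma for the product 2m: a prime above 2 cannot divide the factor 2. This is where
  -- oddness of the prime enters.
  ∣m+m⇒∣m : p > 2 → ∀ {m} → p ∣ m ℕ.+ m → p ∣ m
  ∣m+m⇒∣m p>2 {m} p∣m+m
    with euclidsLemma 2 m pp (subst (p ∣_) (cong (m ℕ.+_) (sym (ℕ.+-identityʳ m))) p∣m+m)
  ... | inj₁ p∣2 = contradiction (∣.∣⇒≤ p∣2) (ℕ.<⇒≱ p>2)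
  ... | inj₂ p∣m = p∣m

-- Zero-divisors of ℤ/n.

module _ (n : ℕ) .{{_ : NonZero n}} where
  private
    module R = CommutativeRing (ℤ/ n)
    infixl 6 _+ₙ_
    _+ₙ_ = R._+_

    Z : Fin n → Set
    Z = IsZeroDivisor (ℤ/ n)

    Z? : Unary.Decidable Z
    Z? = isZeroDivisor? n

    #Z : ℕ
    #Z = ∑[ x < n ] 𝟙 (Z? x)

    deg : Fin n → ℕ
    deg = degree (TΓ (ℤ/ n)) (TΓ-adj? n)

    0%n : 0 % n ≡ 0
    0%n = m<n⇒m%n≡m (ℕ.>-nonZero⁻¹ n)

  π≡0⇒∣ : ∀ {m} → π n m ≡ π n 0 → n ∣ m
  π≡0⇒∣ {m} eq = ∣.m%n≡0⇒n∣m m n (trans (sym (toℕ-π n m)) (trans (cong toℕ eq) (trans (toℕ-π n 0) 0%n)))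

  ∣⇒π≡0 : ∀ {m} → n ∣ m → π n m ≡ π n 0
  ∣⇒π≡0 {m} n∣m = π-cong n (trans (∣.n∣m⇒m%n≡0 m n n∣m) (sym 0%n))

  -- Reduction modulo `n` changes a number by a multiple of `n`, hence of `d`. So divisibility by
  -- `d` can be tested on the unreduced sum, in both directions.
  ∣-⊕⇒ : ∀ {d} → d ∣ n → ∀ x y → d ∣ toℕ (x +ₙ y) → d ∣ toℕ x ℕ.+ toℕ y
  ∣-⊕⇒ {d} d∣n x y d∣ = ∣.∣n∣m%n⇒∣m d∣n (subst (d ∣_) (toℕ-π n (toℕ x ℕ.+ toℕ y)) d∣)

  ∣-⊕⇐ : ∀ {d} → d ∣ n → ∀ x y → d ∣ toℕ x ℕ.+ toℕ y → d ∣ toℕ (x +ₙ y)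
  ∣-⊕⇐ {d} d∣n x y d∣ = subst (d ∣_) (sym (toℕ-π n (toℕ x ℕ.+ toℕ y))) (∣.%-presˡ-∣ d∣ d∣n)

  -- With g = gcd(n, x), the annihilator is q = n/g: the product x q is a multiple of g q = n. If
  -- `q` were 0 modulo `n`, then q = n and g = 1.
  ¬coprime⇒Z : ∀ {x} → ¬ Coprime n (toℕ x) → Z x
  ¬coprime⇒Z {x} ¬c = inj₂ (π n q , q≢0 , xq≡0)
    where
    g = gcd n (toℕ x)
    g∣n = gcd[m,n]∣m n (toℕ x)
    g∣x = gcd[m,n]∣n n (toℕ x)
    q = ∣.quotient g∣n
    n≡gq : n ≡ g ℕ.* q
    n≡gq = ∣.m∣n⇒n≡m*quotient g∣n
    q≢0 : ¬ π n q ≡ π n 0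
    q≢0 eq = ¬c (Coprimality.gcd≡1⇒coprime (ℕ.*-cancelʳ-≡ g 1 n
      (trans (cong (g ℕ.*_) (∣.∣-antisym (π≡0⇒∣ eq) (∣.quotient-∣ g∣n)))
        (trans (sym n≡gq) (sym (ℕ.*-identityˡ n))))))
    xq≡0 : x R.* π n q ≡ π n 0
    xq≡0 = trans (R.*-comm x (π n q)) (trans (π-*ˡ n q x) (∣⇒π≡0
      (subst₂ _∣_ (sym n≡gq) (ℕ.*-comm (toℕ x) q) (∣.*-monoˡ-∣ q g∣x))))

  shared⇒Z : ∀ {d x} → d ≢ 1 → d ∣ n → d ∣ toℕ x → Z x
  shared⇒Z d≢1 d∣n d∣x = ¬coprime⇒Z λ c → d≢1 (c (d∣n , d∣x))

  Z-0 : Z (π n 0)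
  Z-0 = inj₁ refl

  -- The ranges 0, ..., n - 1 and 1, ..., n differ only in their ends 0 and `n`, and either end is
  -- coprime to `n` exactly when n = 1.
  ∑-𝟙-coprime : ∑[ x < n ] 𝟙 (coprime? n (toℕ x)) ≡ φ n
  ∑-𝟙-coprime = sym (begin
    φ n
      ≡⟨ cong (length ∘ filter (coprime? n)) (List.map-upTo suc n) ⟩
    length (filter (coprime? n) (applyUpTo suc n))
      ≡⟨ length-filter-applyUpTo (coprime? n) suc n ⟩
    ∑[ i < n ] 𝟙 (coprime? n (suc (toℕ i)))
      ≡⟨ ℕ.+-cancelˡ-≡ c₀ _ _ (trans (∑-shift (λ i → 𝟙 (coprime? n i)) n)
           (trans (cong (S ℕ.+_) cₙ≡c₀) (ℕ.+-comm S c₀))) ⟩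
    S ∎)
    where
    open ≡-Reasoning
    S = ∑[ x < n ] 𝟙 (coprime? n (toℕ x))
    c₀ = 𝟙 (coprime? n 0)
    cₙ≡c₀ : 𝟙 (coprime? n n) ≡ c₀
    cₙ≡c₀ = 𝟙-⇔ (coprime? n n) (coprime? n 0)
      (λ c (d∣n , _) → c (d∣n , d∣n)) (λ c (d∣n , _) → c (d∣n , _ ∣.∣0))

  -- Degrees in the total graph.

  ∑-𝟙-translate : ∀ x → ∑[ y < n ] 𝟙 (Z? (x +ₙ y)) ≡ #Z
  ∑-𝟙-translate x = sym (∑-permute (λ y → 𝟙 (Z? y)) translation)
    where
    cancel : ∀ a b → a +ₙ b ≡ π n 0 → ∀ y → a +ₙ (b +ₙ y) ≡ y
    cancel a b ab≡0 y = trans (sym (R.+-assoc a b y)) (trans (cong (_+ₙ y) ab≡0) (R.+-identityˡ y))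
    translation : Permutation′ n
    translation = permutation (x +ₙ_) ((R.- x) +ₙ_)
      (cancel x (R.- x) (R.-‿inverseʳ x)) (cancel (R.- x) x (R.-‿inverseˡ x))

  -- The translates x + y that are zero-divisors come from the neighbours `y` of `x` and possibly
  -- from y = x, which adjacency excludes. The indicator restores that missing loop.
  degree+loop : ∀ x → deg x ℕ.+ 𝟙 (Z? (x +ₙ x)) ≡ #Z
  degree+loop x = begin
    deg x ℕ.+ ℓ
      ≡⟨ cong₂ ℕ._+_ (length-filter-tabulate (TΓ-adj? n x) id) (sym (ℕ.*-identityˡ ℓ)) ⟩
    ∑[ y < n ] 𝟙 (TΓ-adj? n x y) ℕ.+ 1 ℕ.* ℓ
      -- The factor 1 is written as the sum over `y` of the indicator of x = y, which moves the loop
      -- term under the sum.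
      ≡⟨ cong (λ s → ∑[ y < n ] 𝟙 (TΓ-adj? n x y) ℕ.+ s ℕ.* ℓ) (∑-𝟙-≟ x) ⟨
    ∑[ y < n ] 𝟙 (TΓ-adj? n x y) ℕ.+ (∑[ y < n ] 𝟙 (x Fin.≟ y)) ℕ.* ℓ
      ≡⟨ cong (∑[ y < n ] 𝟙 (TΓ-adj? n x y) ℕ.+_) (*-distribʳ-sum ℓ (λ y → 𝟙 (x Fin.≟ y))) ⟩
    ∑[ y < n ] 𝟙 (TΓ-adj? n x y) ℕ.+ ∑[ y < n ] (𝟙 (x Fin.≟ y) ℕ.* ℓ)
      ≡⟨ ∑-distrib-+ (λ y → 𝟙 (TΓ-adj? n x y)) (λ y → 𝟙 (x Fin.≟ y) ℕ.* ℓ) ⟨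
    ∑[ y < n ] (𝟙 (TΓ-adj? n x y) ℕ.+ 𝟙 (x Fin.≟ y) ℕ.* ℓ)
      ≡⟨ sum-cong-≗ split ⟩
    ∑[ y < n ] 𝟙 (Z? (x +ₙ y))
      ≡⟨ ∑-𝟙-translate x ⟩
    #Z ∎
    where
    open ≡-Reasoning
    ℓ = 𝟙 (Z? (x +ₙ x))
    split : ∀ y → 𝟙 (TΓ-adj? n x y) ℕ.+ 𝟙 (x Fin.≟ y) ℕ.* ℓ ≡ 𝟙 (Z? (x +ₙ y))
    split y = by-cases (x Fin.≟ y)
      where
      by-cases : Dec (x ≡ y) → 𝟙 (TΓ-adj? n x y) ℕ.+ 𝟙 (x Fin.≟ y) ℕ.* ℓ ≡ 𝟙 (Z? (x +ₙ y))
      by-cases (yes refl) = trans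
        (cong₂ (λ i j → i ℕ.+ j ℕ.* ℓ) (𝟙-no (TΓ-adj? n x x) (irrefl (TΓ (ℤ/ n)) {x}))
          (𝟙-yes (x Fin.≟ x) refl))
        (ℕ.*-identityˡ ℓ)
      by-cases (no x≢y) = trans
        (cong₂ (λ i j → i ℕ.+ j ℕ.* ℓ)
          (𝟙-⇔ (TΓ-adj? n x y) (Z? (x +ₙ y)) proj₂ (x≢y ,_)) (𝟙-no (x Fin.≟ y) x≢y))
        (ℕ.+-identityʳ _)

  module _ (n≥2 : n ≥ 2) where
    -- Zero is coprime to `n` only for n = 1. Otherwise `n` divides x y with `y` nonzero modulo `n`;
    -- coprimality would make `n` divide `y`.
    Z⇒¬coprime : ∀ {x} → Z x → ¬ Coprime n (toℕ x)
    Z⇒¬coprime {x} (inj₁ refl) c =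
      ℕ.>⇒≢ n≥2 (c (∣.∣-refl , subst (n ∣_) (sym (trans (toℕ-π n 0) 0%n)) (n ∣.∣0)))
    Z⇒¬coprime {x} (inj₂ (y , y≢0 , xy≡0)) c =
      y≢0 (trans (sym (π-toℕ n y)) (∣⇒π≡0 (Coprimality.coprime-divisor c (π≡0⇒∣ xy≡0))))

    𝟙-Z+𝟙-coprime : ∀ x → 𝟙 (Z? x) ℕ.+ 𝟙 (coprime? n (toℕ x)) ≡ 1
    𝟙-Z+𝟙-coprime x = 𝟙-¬ (Z? x) (coprime? n (toℕ x)) Z⇒¬coprime λ ¬z → coprime (¬z ∘ ¬coprime⇒Z {x})
      where
      coprime : ¬ ¬ Coprime n (toℕ x) → Coprime n (toℕ x)
      coprime = decidable-stable (coprime? n (toℕ x))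

    #Z+φ : #Z ℕ.+ φ n ≡ n
    #Z+φ = begin
      #Z ℕ.+ φ n
        ≡⟨ cong (#Z ℕ.+_) ∑-𝟙-coprime ⟨
      #Z ℕ.+ ∑[ x < n ] 𝟙 (coprime? n (toℕ x))
        ≡⟨ ∑-distrib-+ (λ x → 𝟙 (Z? x)) (λ x → 𝟙 (coprime? n (toℕ x))) ⟨
      ∑[ x < n ] (𝟙 (Z? x) ℕ.+ 𝟙 (coprime? n (toℕ x)))
        ≡⟨ sum-cong-≗ 𝟙-Z+𝟙-coprime ⟩
      ∑[ x < n ] 1
        ≡⟨ trans (∑-const n 1) (ℕ.*-identityʳ n) ⟩
      n ∎
      where open ≡-Reasoning

    private
      -- The vertex 0 carries a loop in the sense of `degree+loop`, so its degree is the natural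
      -- number n - φ(n) - 1 of the formulas.
      d₀ = deg (π n 0)

      d₀+1 : d₀ ℕ.+ 1 ≡ #Z
      d₀+1 = trans (cong (d₀ ℕ.+_) (sym (𝟙-yes (Z? (π n 0 +ₙ π n 0))
        (subst Z (sym (R.+-identityˡ (π n 0))) Z-0)))) (degree+loop (π n 0))

      z : ℚ
      z = fromℕ n ℚ.- fromℕ (φ n)

      z≡ : z ≡ fromℕ #Z
      z≡ = fromℕ-∸ #Z (φ n) #Z+φ

      z-1≡ : z ℚ.- 1ℚ ≡ fromℕ d₀
      z-1≡ = trans (cong (ℚ._- 1ℚ) z≡) (fromℕ-∸ d₀ 1 d₀+1)

      square : ∀ q a → q ≡ fromℕ a → q ℚ.* q ≡ fromℕ (a ℕ.* a)
      square q a refl = sym (fromℕ-* a a)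

    -- Even moduli.

    SO-even : 2 ∣ n → SO (TΓ (ℤ/ n)) (TΓ-adj? n) ≃ (ι n * (ι n - ι (φ n) - ι 1) ²) ÷ √ 2
    SO-even 2∣n = SO-balanced (TΓ (ℤ/ n)) (TΓ-adj? n)
      (λ {u} {v} _ → trans (regular u) (sym (regular v)))
      (ι n * (ι n - ι (φ n) - ι 1) ²)
      λ _ → begin
        fromℕ n ℚ.* ((z ℚ.- 1ℚ) ℚ.* (z ℚ.- 1ℚ))   ≡⟨ cong (fromℕ n ℚ.*_) (square (z ℚ.- 1ℚ) d₀ z-1≡) ⟩
        fromℕ n ℚ.* fromℕ (d₀ ℕ.* d₀)             ≡⟨ fromℕ-* n (d₀ ℕ.* d₀) ⟨
        fromℕ (n ℕ.* (d₀ ℕ.* d₀))                 ≡⟨ cong fromℕ (trans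
                                                       (sum-cong-≗ (λ u → cong₂ ℕ._*_ (regular u) (regular u)))
                                                       (∑-const n (d₀ ℕ.* d₀))) ⟨
        fromℕ (∑[ u < n ] (deg u ℕ.* deg u))      ∎
      where
      open ≡-Reasoning
      -- Reduction modulo an even `n` preserves parity, so 2 is a common divisor of `n` and the
      -- residue of 2u.
      loop : ∀ u → Z (u +ₙ u)
      loop u = shared⇒Z (λ ()) 2∣n (∣-⊕⇐ 2∣n u u (subst (2 ∣_)
        (cong (toℕ u ℕ.+_) (ℕ.+-identityʳ (toℕ u))) (∣.m∣m*n (toℕ u))))
      regular : ∀ u → deg u ≡ d₀
      regular u = ℕ.+-cancelʳ-≡ 1 (deg u) d₀ (trans
        (cong (deg u ℕ.+_) (sym (𝟙-yes (Z? (u +ₙ u)) (loop u)))) (trans (degree+loop u) (sym d₀+1)))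

    -- Powers of an odd prime.

    SO-prime-power : ∀ {p} → Prime p → ∀ α → α ≥ 1 → p > 2 → n ≡ p ^ α →
      SO (TΓ (ℤ/ n)) (TΓ-adj? n)
        ≃ (ι (φ n) * (ι n - ι (φ n)) ²) ÷ √ 2 + ((ι n - ι (φ n) - ι 1) ² * (ι n - ι (φ n))) ÷ √ 2
    SO-prime-power {p} pp α α≥1 p>2 n≡p^α =
      ≃-trans {SO (TΓ (ℤ/ n)) (TΓ-adj? n)} {(X + Y) ÷ √ 2} {X ÷ √ 2 + Y ÷ √ 2}
        (SO-balanced (TΓ (ℤ/ n)) (TΓ-adj? n) (λ {u} {v} → balanced u v) (X + Y) λ _ → begin
          fromℕ (φ n) ℚ.* (z ℚ.* z) ℚ.+ (z ℚ.- 1ℚ) ℚ.* (z ℚ.- 1ℚ) ℚ.* z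
            ≡⟨ cong₂ ℚ._+_ (cong (fromℕ (φ n) ℚ.*_) (square z #Z z≡)) (cong₂ ℚ._*_ (square (z ℚ.- 1ℚ) d₀ z-1≡) z≡) ⟩
          fromℕ (φ n) ℚ.* fromℕ (#Z ℕ.* #Z) ℚ.+ fromℕ (d₀ ℕ.* d₀) ℚ.* fromℕ #Z
            ≡⟨ cong₂ ℚ._+_ (fromℕ-* (φ n) (#Z ℕ.* #Z)) (fromℕ-* (d₀ ℕ.* d₀) #Z) ⟨
          fromℕ (φ n ℕ.* (#Z ℕ.* #Z)) ℚ.+ fromℕ (d₀ ℕ.* d₀ ℕ.* #Z)
            ≡⟨ fromℕ-+ (φ n ℕ.* (#Z ℕ.* #Z)) (d₀ ℕ.* d₀ ℕ.* #Z) ⟨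
          fromℕ (φ n ℕ.* (#Z ℕ.* #Z) ℕ.+ d₀ ℕ.* d₀ ℕ.* #Z)
            ≡⟨ cong fromℕ ∑deg² ⟨
          fromℕ (∑[ u < n ] (deg u ℕ.* deg u)) ∎)
        -- Both quotients use the same reciprocal sequence, so the sum splits term by term.
        (≗⇒≃ {(X + Y) ÷ √ 2} {X ÷ √ 2 + Y ÷ √ 2} λ k →
          ℚ.*-distribʳ-+ (recip (√-seq 2 k)) (seq X k) (seq Y k))
      where
      open ≡-Reasoning
      X = ι (φ n) * (ι n - ι (φ n)) ²
      Y = (ι n - ι (φ n) - ι 1) ² * (ι n - ι (φ n))

      p∣n : p ∣ n
      p∣n = subst (p ∣_) (sym n≡p^α) (∣p^ α α≥1)
        where
        ∣p^ : ∀ β → β ≥ 1 → p ∣ p ^ β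
        ∣p^ (suc β) _ = ∣.m∣m*n (p ^ β)

      -- By contraposition: a residue that `p` does not divide is coprime to p^α.
      Z⇒p∣ : ∀ {x} → Z x → p ∣ toℕ x
      Z⇒p∣ {x} zx = decidable-stable (p ∣.∣? toℕ x) λ p∤x →
        Z⇒¬coprime zx (subst (λ m → Coprime m (toℕ x)) (sym n≡p^α) (∤⇒coprime-^ pp α p∤x))

      p∣⇒Z : ∀ {x} → p ∣ toℕ x → Z x
      p∣⇒Z = shared⇒Z (λ { refl → ¬prime[1] pp }) p∣n

      -- The loop condition on 2u becomes one on `u`, because `p` divides 2u exactly when it divides
      -- `u`.
      deg+𝟙 : ∀ u → deg u ℕ.+ 𝟙 (Z? u) ≡ #Z
      deg+𝟙 u = trans (cong (deg u ℕ.+_) (𝟙-⇔ (Z? u) (Z? (u +ₙ u))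
        (λ zu → p∣⇒Z (∣-⊕⇐ p∣n u u (∣.∣m∣n⇒∣m+n (Z⇒p∣ zu) (Z⇒p∣ zu))))
        (λ z2u → p∣⇒Z (∣m+m⇒∣m pp p>2 (∣-⊕⇒ p∣n u u (Z⇒p∣ z2u)))))) (degree+loop u)

      -- Adjacency gives that `p` divides u + v, so it divides both of `u` and `v` or neither; the
      -- indicators in `deg+𝟙` then agree and cancel.
      balanced : ∀ u v → Adj (TΓ (ℤ/ n)) u v → deg u ≡ deg v
      balanced u v (_ , zu+v) = ℕ.+-cancelʳ-≡ (𝟙 (Z? u)) (deg u) (deg v) (trans (deg+𝟙 u)
        (trans (sym (deg+𝟙 v)) (cong (deg v ℕ.+_) (𝟙-⇔ (Z? v) (Z? u)
          (λ zv → p∣⇒Z (∣.∣m+n∣m⇒∣n (subst (p ∣_) (ℕ.+-comm (toℕ u) (toℕ v)) p∣u+v) (Z⇒p∣ zv)))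
          (λ zu → p∣⇒Z (∣.∣m+n∣m⇒∣n p∣u+v (Z⇒p∣ zu)))))))
        where
        p∣u+v : p ∣ toℕ u ℕ.+ toℕ v
        p∣u+v = ∣-⊕⇒ p∣n u v (Z⇒p∣ zu+v)

      -- Exactly one of the two indicators is 1: a unit has degree `#Z`, a zero-divisor has degree
      -- `d₀`.
      deg² : ∀ u → deg u ℕ.* deg u ≡
        𝟙 (coprime? n (toℕ u)) ℕ.* (#Z ℕ.* #Z) ℕ.+ 𝟙 (Z? u) ℕ.* (d₀ ℕ.* d₀)
      deg² u = cases (𝟙 (Z? u)) (𝟙 (coprime? n (toℕ u))) (𝟙-Z+𝟙-coprime u) (deg+𝟙 u)
        where
        -- The indicators are generalised to naturals with sum 1, so that the case split is on
        -- numbers and not on the decision procedures.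
        cases : ∀ a b → a ℕ.+ b ≡ 1 → deg u ℕ.+ a ≡ #Z →
          deg u ℕ.* deg u ≡ b ℕ.* (#Z ℕ.* #Z) ℕ.+ a ℕ.* (d₀ ℕ.* d₀)
        cases zero       1 refl eq = trans (cong (λ i → i ℕ.* i) (trans (sym (ℕ.+-identityʳ (deg u))) eq))
          (sym (trans (ℕ.+-identityʳ _) (ℕ.*-identityˡ _)))
        cases (suc zero) 0 refl eq = trans
          (cong (λ i → i ℕ.* i) (ℕ.+-cancelʳ-≡ 1 (deg u) d₀ (trans eq (sym d₀+1))))
          (sym (ℕ.*-identityˡ _))

      ∑deg² : ∑[ u < n ] (deg u ℕ.* deg u) ≡ φ n ℕ.* (#Z ℕ.* #Z) ℕ.+ d₀ ℕ.* d₀ ℕ.* #Z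
      ∑deg² = begin
        ∑[ u < n ] (deg u ℕ.* deg u)
          ≡⟨ sum-cong-≗ deg² ⟩
        ∑[ u < n ] (c u ℕ.* (#Z ℕ.* #Z) ℕ.+ 𝟙 (Z? u) ℕ.* (d₀ ℕ.* d₀))
          ≡⟨ ∑-distrib-+ (λ u → c u ℕ.* (#Z ℕ.* #Z)) (λ u → 𝟙 (Z? u) ℕ.* (d₀ ℕ.* d₀)) ⟩
        ∑[ u < n ] (c u ℕ.* (#Z ℕ.* #Z)) ℕ.+ ∑[ u < n ] (𝟙 (Z? u) ℕ.* (d₀ ℕ.* d₀))
          ≡⟨ cong₂ ℕ._+_ (*-distribʳ-sum (#Z ℕ.* #Z) c) (*-distribʳ-sum (d₀ ℕ.* d₀) (λ u → 𝟙 (Z? u))) ⟨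
        (∑[ u < n ] c u) ℕ.* (#Z ℕ.* #Z) ℕ.+ #Z ℕ.* (d₀ ℕ.* d₀)
          ≡⟨ cong₂ (λ i j → i ℕ.* (#Z ℕ.* #Z) ℕ.+ j) ∑-𝟙-coprime (ℕ.*-comm #Z (d₀ ℕ.* d₀)) ⟩
        φ n ℕ.* (#Z ℕ.* #Z) ℕ.+ d₀ ℕ.* d₀ ℕ.* #Z ∎
        where
        c : Fin n → ℕ
        c u = 𝟙 (coprime? n (toℕ u))

theorem3p1 : (n : ℕ) .{{_ : NonZero n}} → n ≥ 2 →
    (p : ℕ) → Prime p →
    (2 ∣ n →
    SO (TΓ (ℤ/ n)) (TΓ-adj? n)
    ≃ (ι n * (ι n - ι (φ n) - ι 1) ²) ÷ √ 2)
    ×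
    ((α : ℕ) → α ≥ 1 → p > 2 → n ≡ p ^ α →
    SO (TΓ (ℤ/ n)) (TΓ-adj? n)
    ≃ (ι (φ n) * (ι n - ι (φ n)) ²) ÷ √ 2
    + ((ι n - ι (φ n) - ι 1) ² * (ι n - ι (φ n))) ÷ √ 2)
theorem3p1 n n≥2 p pp = SO-even n n≥2 , SO-prime-power n n≥2 pp
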